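{- As formal power series in $q$ (equivalently for $|q|<1$), $$\sum_{m,n\geq 0} \frac{q^{2m^2 + 6mn +6n^2 -2m-3n}}{(q;q)_m(q^3;q^3)_n} = (-q^2,-q^4;q^6)_\infty(-q^3;q^3)_\infty + (-q,-q^5;q^6)_\infty(-q^3;q^3)_\infty .$$
   Context: $(a;q)_n=\prod_{i=0}^{n-1}(1-aq^i)$, $(a;q)_\infty=\prod_{i\ge0}(1-aq^i)$, and $(a_1,\dots,a_k;q)_\infty=(a_1;q)_\infty\cdots(a_k;q)_\infty$. -}

module Defs where

-- Formal power series in q with integer coefficients, represented by their
-- coefficient sequences:  a : FPS  stands for  Σ_N a N · q^N.

open import Data.Nat as ℕ using (ℕ; zero; suc; _∸_; _≤?_; _≟_)
open import Data.Nat.Divisibility using (_∣?_)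
open import Data.Integer using (ℤ; +_; -_)
import Data.Integer as ℤ
open import Relation.Nullary.Decidable using (Dec; yes; no)

FPS : Set
FPS = ℕ → ℤ

Σ< : ℕ → (ℕ → ℤ) → ℤ
Σ< zero    f = + 0
Σ< (suc n) f = Σ< n f ℤ.+ f n

_⊕_ : FPS → FPS → FPS
(a ⊕ b) N = a N ℤ.+ b N
infixl 6 _⊕_

_⊛_ : FPS → FPS → FPS
(a ⊛ b) N = Σ< (suc N) (λ k → a k ℤ.* b (N ∸ k))
infixl 7 _⊛_

one : FPS
one N with N ≟ 0
... | yes _ = + 1
... | no  _ = + 0

mon : ℕ → FPS
mon e N with N ≟ e
... | yes _ = + 1
... | no  _ = + 0

∏< : ℕ → (ℕ → FPS) → FPS
∏< zero    f = one
∏< (suc n) f = ∏< n f ⊛ f n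

-- infinite product ∏_{i≥0} f i, for factors with f i ≡ 1 mod q^{i+1}
-- (the standard q-adic limit): the coefficient of q^N is already that of
-- the finite product over i ≤ N.
∏∞ : (ℕ → FPS) → FPS
∏∞ f N = ∏< (suc N) f N

-- the geometric series 1/(1 - q^k) = Σ_j q^{kj}   (used with k ≥ 1)
geom : ℕ → FPS
geom k N with k ∣? N
... | yes _ = + 1
... | no  _ = + 0

invPoch : ℕ → ℕ → FPS
invPoch d n = ∏< n (λ i → geom (d ℕ.* suc i))

-- (-q^c;q^d)_∞ = ∏_{i≥0} (1 + q^{c + d i})   (used with c ≥ 1)
negPoch∞ : ℕ → ℕ → FPS
negPoch∞ c d = ∏∞ (λ i → one ⊕ mon (c ℕ.+ d ℕ.* i))

-- exponent 2m^2 + 6mn + 6n^2 - 2m - 3n  (always ≥ 0)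
expo : ℕ → ℕ → ℕ
expo m n = (2 ℕ.* m ℕ.* m ℕ.+ 6 ℕ.* m ℕ.* n ℕ.+ 6 ℕ.* n ℕ.* n) ∸ (2 ℕ.* m ℕ.+ 3 ℕ.* n)

shift : ℕ → FPS → FPS
shift e a N with e ≤? N
... | yes _ = a (N ∸ e)
... | no  _ = + 0

term : ℕ → ℕ → FPS
term m n = shift (expo m n) (invPoch 1 m ⊛ invPoch 3 n)

-- the double sum Σ_{m,n≥0} term m n.  Since expo m n ≥ m for m ≥ 2 and
-- expo m n ≥ n for n ≥ 1, only m, n ≤ N+1 contribute to the coefficient
-- of q^N, so this is the exact coefficient of the infinite double sum.
lhs : FPS
lhs N = Σ< (suc (suc N)) (λ m → Σ< (suc (suc N)) (λ n → term m n N))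

rhs : FPS
rhs = negPoch∞ 2 6 ⊛ negPoch∞ 4 6 ⊛ negPoch∞ 3 3
    ⊕ negPoch∞ 1 6 ⊛ negPoch∞ 5 6 ⊛ negPoch∞ 3 3

{-# OPTIONS --safe #-}

-- Put p = q³, k = m + 2n and tri k = k(k-1)/2.  The exponent is 3 tri k + tri m, so the left side
-- is Σ_k p^{tri k} [z^k] F(z) with F(z) = (-z;q)_∞ / (z²;p)_∞.  For a = q, b = q², so that ab = p,
-- splitting (-z;q)_∞ modulo 3 gives
--   F(z) = e(z) / (z;p)_∞,   e(z) = (-az,-bz;p)_∞ / (abz²;p²)_∞.
-- Expanding 1/(z;p)_∞ and summing by Euler's identity, the left side becomes
--   Σ_s p^{tri s} e_s (-p^s;p)_∞.
-- Let X(z) = (-bz,-apz;p²)_∞ and Y(z) = (-az,-bpz;p²)_∞, so that X(z) = (1 + bz) Y(pz) and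
-- Y(z) = (1 + az) X(pz).  Comparing recurrences in s yields
--   (1 + p^s) p^{tri s} e_s = (X_s + Y_s) (-p;p)_s,
-- hence each summand equals (-p;p)_∞ (X_s + Y_s), and the left side is (-p;p)_∞ (X(1) + Y(1)).
module Submission where

open import Defs
open import Algebra.Bundles using (CommutativeRing; RawRing)
import Algebra.Construct.Pointwise as Pointwise
import Algebra.Morphism.RingMonomorphism as RingMonomorphism
open import Algebra.Morphism.Structures using (IsRingMonomorphism)
import Algebra.Properties.CommutativeSemiring.Exp as Exp
import Algebra.Properties.Group as GroupProperties
import Algebra.Solver.Ring.NaturalCoefficients.Default as Solver
open import Data.Integer as ℤ using (ℤ; 0ℤ; 1ℤ) renaming (_+_ to _+ℤ_; _*_ to _*ℤ_)
import Data.Integer.Properties as ℤₚ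
open import Data.Nat as ℕ using (ℕ; zero; suc; _∸_; _≤?_; _≟_)
open import Data.Nat.Divisibility using (_∣_; _∣?_; _∣0; ∣m∸n∣n⇒∣m; ∣m+n∣m⇒∣n; ∣-refl; >⇒∤)
open import Data.Nat.Induction using (<-rec)
import Data.Nat.Properties as ℕₚ
import Data.Nat.Solver
open import Data.Product using (_,_)
open import Data.Sum using (inj₁; inj₂)
open import Function using (_∘_; id; flip)
open import Level using (Level)
import Relation.Binary.Reasoning.Setoid as SetoidReasoning
open import Relation.Binary.PropositionalEquality as ≡ using (_≡_)
open import Relation.Nullary using (¬_; yes; no; contradiction)

module ℕSolver = Data.Nat.Solver.+-*-Solver

-- Formal power series over a commutative ring.

module Series {c ℓ : Level} (R : CommutativeRing c ℓ) where
  open CommutativeRing R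
  open Exp commutativeSemiring using (_^_; ^-homo-*)
  open SetoidReasoning setoid
  open Solver commutativeSemiring using (solve; _:=_; _:+_; _:*_)

  Seq : Set c
  Seq = ℕ → Carrier

  infix 4 _≋_
  _≋_ : Seq → Seq → Set ℓ
  f ≋ g = ∀ n → f n ≈ g n

  -- diag h n = Σ_{i+j=n} h i j
  diag : (ℕ → Seq) → Seq
  diag h zero    = h 0 0
  diag h (suc n) = h 0 (suc n) + diag (h ∘ suc) n

  diag-cong : ∀ {h k} → (∀ i → h i ≋ k i) → diag h ≋ diag k
  diag-cong e zero    = e 0 0
  diag-cong e (suc n) = +-cong (e 0 (suc n)) (diag-cong (e ∘ suc) n)

  diag-+ : ∀ h k → diag (λ i j → h i j + k i j) ≋ λ n → diag h n + diag k n
  diag-+ h k zero    = refl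
  diag-+ h k (suc n) = trans (+-congˡ (diag-+ (h ∘ suc) (k ∘ suc) n))
    (solve 4 (λ a b x y → (a :+ b) :+ (x :+ y) := (a :+ x) :+ (b :+ y)) refl _ _ _ _)

  -- The index i + j is constant along an antidiagonal, so the weight moves inside. Used for powers
  -- r^n and for the weights p^{tri n}.
  diag-weight : ∀ (w : Seq) h n → w n * diag h n ≈ diag (λ i j → w (i ℕ.+ j) * h i j) n
  diag-weight w h zero    = refl
  diag-weight w h (suc n) = trans (distribˡ _ _ _) (+-congˡ (diag-weight (w ∘ suc) (h ∘ suc) n))

  diag-last : ∀ h n → diag h (suc n) ≈ diag (λ i → h i ∘ suc) n + h (suc n) 0
  diag-last h zero    = refl
  diag-last h (suc n) = trans (+-congˡ (diag-last (h ∘ suc) n)) (sym (+-assoc _ _ _))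

  diag-flip : ∀ h → diag h ≋ diag (flip h)
  diag-flip h zero    = refl
  diag-flip h (suc n) = begin
    h 0 (suc n) + diag (h ∘ suc) n         ≈⟨ +-comm _ _ ⟩
    diag (h ∘ suc) n + h 0 (suc n)         ≈⟨ +-congʳ (diag-flip (h ∘ suc) n) ⟩
    diag (flip (h ∘ suc)) n + h 0 (suc n)  ≈⟨ diag-last (flip h) n ⟨
    diag (flip h) (suc n)                  ∎

  infixl 7 _⋆_
  _⋆_ : Seq → Seq → Seq
  f ⋆ g = diag (λ i j → f i * g j)

  δ : Seq
  δ zero    = 1#
  δ (suc _) = 0#

  ⋆-cong : ∀ {f f′ g g′} → f ≋ f′ → g ≋ g′ → f ⋆ g ≋ f′ ⋆ g′
  ⋆-cong e e′ = diag-cong (λ i j → *-cong (e i) (e′ j))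

  ⋆-distribʳ : ∀ f g h → (λ n → g n + h n) ⋆ f ≋ λ n → (g ⋆ f) n + (h ⋆ f) n
  ⋆-distribʳ f g h n = trans (diag-cong (λ i j → distribʳ _ _ _) n) (diag-+ _ _ n)

  ⋆-scaleˡ : ∀ c f g n → ((λ k → c * f k) ⋆ g) n ≈ c * (f ⋆ g) n
  ⋆-scaleˡ c f g n =
    trans (diag-cong (λ i j → *-assoc _ _ _) n) (sym (diag-weight (λ _ → c) _ n))

  ⋆-zeroˡ : ∀ {z} f → (∀ n → z n ≈ 0#) → ∀ n → (z ⋆ f) n ≈ 0#
  ⋆-zeroˡ f e zero    = trans (*-congʳ (e 0)) (zeroˡ _)
  ⋆-zeroˡ f e (suc n) =
    trans (+-cong (trans (*-congʳ (e 0)) (zeroˡ _)) (⋆-zeroˡ f (e ∘ suc) n)) (+-identityˡ _)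

  ⋆-comm : ∀ f g → f ⋆ g ≋ g ⋆ f
  ⋆-comm f g n = trans (diag-flip _ n) (diag-cong (λ i j → *-comm _ _) n)

  -- Induction on the coefficient index, peeling the constant term off `f`; the tail of `f ⋆ g` is
  -- then a scalar multiple of the tail of `g` plus a shorter product.
  ⋆-assoc : ∀ f g h → (f ⋆ g) ⋆ h ≋ f ⋆ (g ⋆ h)
  ⋆-assoc f g h zero    = *-assoc _ _ _
  ⋆-assoc f g h (suc n) = begin
    f 0 * g 0 * h (suc n) + (((λ k → f 0 * g (suc k) + ((f ∘ suc) ⋆ g) k)) ⋆ h) n
      ≈⟨ +-congˡ (⋆-distribʳ h _ _ n) ⟩
    f 0 * g 0 * h (suc n) + (((λ k → f 0 * g (suc k)) ⋆ h) n + (((f ∘ suc) ⋆ g) ⋆ h) n)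
      ≈⟨ +-congˡ (+-cong (⋆-scaleˡ _ _ _ n) (⋆-assoc (f ∘ suc) g h n)) ⟩
    f 0 * g 0 * h (suc n) + (f 0 * ((g ∘ suc) ⋆ h) n + ((f ∘ suc) ⋆ (g ⋆ h)) n)
      ≈⟨ solve 5 (λ a b x y z → a :* b :* x :+ (a :* y :+ z) := a :* (b :* x :+ y) :+ z) refl _ _ _ _ _ ⟩
    f 0 * (g 0 * h (suc n) + ((g ∘ suc) ⋆ h) n) + ((f ∘ suc) ⋆ (g ⋆ h)) n ∎

  ⋆-identityˡ : ∀ f → δ ⋆ f ≋ f
  ⋆-identityˡ f zero    = *-identityˡ _
  ⋆-identityˡ f (suc n) =
    trans (+-cong (*-identityˡ _) (⋆-zeroˡ f (λ _ → refl) n)) (+-identityʳ _)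

  seriesRing : CommutativeRing c ℓ
  seriesRing = record
    { Carrier = Seq
    ; _≈_ = _≋_
    ; _+_ = λ f g n → f n + g n
    ; _*_ = _⋆_
    ; -_ = λ f n → - f n
    ; 0# = λ _ → 0#
    ; 1# = δ
    ; isCommutativeRing = record
      { isRing = record
        { +-isAbelianGroup = Pointwise.isAbelianGroup ℕ +-isAbelianGroup
        ; *-cong = ⋆-cong
        ; *-assoc = ⋆-assoc
        ; *-identity = ⋆-identityˡ , λ f n → trans (⋆-comm f δ n) (⋆-identityˡ f n)
        ; distrib = (λ f g h n → trans (⋆-comm f _ n) (trans (⋆-distribʳ f g h n)
                      (+-cong (⋆-comm g f n) (⋆-comm h f n))))
                  , ⋆-distribʳ
        }
      ; *-comm = ⋆-comm
      }
    }

  -- The substitution f(z) → f(rz).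
  scale : Carrier → Seq → Seq
  scale r f n = r ^ n * f n

  scale-⋆ : ∀ r f g → scale r (f ⋆ g) ≋ scale r f ⋆ scale r g
  scale-⋆ r f g n = trans (diag-weight (r ^_) _ n) (diag-cong (λ i j →
    trans (*-congʳ (^-homo-* r i j))
      (solve 4 (λ a b x y → a :* b :* (x :* y) := a :* x :* (b :* y)) refl _ _ _ _)) n)

-- Subtraction-free identities in a commutative ring.

module RingLemmas {c ℓ : Level} (R : CommutativeRing c ℓ) where
  open CommutativeRing R
  open GroupProperties +-group using () renaming (∙-cancelʳ to +-cancelʳ)
  open SetoidReasoning setoid
  open Solver commutativeSemiring

  *-interchange₅ : ∀ a b c d e → (a * b * (c * d)) * e ≈ (a * c) * (b * (d * e))
  *-interchange₅ = solve 5 (λ a b c d e → (a :* b :* (c :* d)) :* e := (a :* c) :* (b :* (d :* e))) refl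

  geom-solves : ∀ {G P} c → G ≈ 1# + P * G → G * c ≈ P * (G * c) + c
  geom-solves {G} {P} c G≈ = begin
    G * c             ≈⟨ *-congʳ G≈ ⟩
    (1# + P * G) * c  ≈⟨ solve 3 (λ G P c → (con 1 :+ P :* G) :* c := P :* (G :* c) :+ c) refl G P c ⟩
    P * (G * c) + c   ∎

  -- Here `G` inverts 1 - P. Multiplying (1 - P)z + d = c by `G` gives z + Gd = Gc, which determines
  -- z.
  geom-unique : ∀ {G P c d x y} → G ≈ 1# + P * G →
                x + d ≈ P * x + c → y + d ≈ P * y + c → x ≈ y
  geom-unique {G} {P} {c} {d} {x} {y} G≈ ex ey =
    +-cancelʳ (G * d) x y (trans (value ex) (sym (value ey)))
    where
    value : ∀ {z} → z + d ≈ P * z + c → z + G * d ≈ G * c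
    value {z} ez = +-cancelʳ (P * (G * z)) _ _ (begin
      z + G * d + P * (G * z)
        ≈⟨ solve 4 (λ z G P d → z :+ G :* d :+ P :* (G :* z) := (con 1 :+ P :* G) :* z :+ G :* d) refl z G P d ⟩
      (1# + P * G) * z + G * d  ≈⟨ +-congʳ (*-congʳ G≈) ⟨
      G * z + G * d             ≈⟨ distribˡ _ _ _ ⟨
      G * (z + d)               ≈⟨ *-congˡ ez ⟩
      G * (P * z + c)
        ≈⟨ solve 4 (λ z G P c → G :* (P :* z :+ c) := G :* c :+ P :* (G :* z)) refl z G P c ⟩
      G * c + P * (G * z)       ∎)

  geom-unique₀ : ∀ {G P c x y} → G ≈ 1# + P * G →
                 x ≈ P * x + c → y ≈ P * y + c → x ≈ y
  geom-unique₀ G≈ ex ey =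
    geom-unique G≈ (trans (+-identityʳ _) ex) (trans (+-identityʳ _) ey)

  -- With Z = z and π = p, both lemmas say (1 - z²)(1 - pz²) f(z) = Q f(pz), with the
  -- negative terms moved to the other side.
  product-equation₁ : ∀ Z π Q {u u₁ v v₁ v₂} → u ≈ Q * u₁ → v ≈ v₁ + Z * Z * v →
    v₁ ≈ v₂ + π * (Z * Z) * v₁ →
    u * v + π * (Z * Z * Z * Z) * (u * v) ≈ (Z * Z + π * (Z * Z)) * (u * v) + Q * (u₁ * v₂)
  product-equation₁ Z π Q {u} {u₁} {v} {v₁} {v₂} eu ev ev₁ = begin
    u * v + π * (Z * Z * Z * Z) * (u * v)
      ≈⟨ solve 4 (λ Z π u v → u :* v :+ π :* (Z :* Z :* Z :* Z) :* (u :* v)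
                     := u :* (v :+ π :* (Z :* Z :* Z :* Z) :* v)) refl Z π u v ⟩
    u * (v + π * (Z * Z * Z * Z) * v)
      ≈⟨ *-congˡ (+-congʳ (trans ev (+-congʳ ev₁))) ⟩
    u * (v₂ + π * (Z * Z) * v₁ + Z * Z * v + π * (Z * Z * Z * Z) * v)
      ≈⟨ solve 6 (λ Z π u v v₁ v₂ →
           u :* (v₂ :+ π :* (Z :* Z) :* v₁ :+ Z :* Z :* v :+ π :* (Z :* Z :* Z :* Z) :* v)
           := u :* v₂ :+ u :* (Z :* Z :* v :+ π :* (Z :* Z) :* (v₁ :+ Z :* Z :* v)))
           refl Z π u v v₁ v₂ ⟩
    u * v₂ + u * (Z * Z * v + π * (Z * Z) * (v₁ + Z * Z * v))
      ≈⟨ +-cong (*-congʳ eu) (*-congˡ (+-congˡ (*-congˡ (sym ev)))) ⟩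
    Q * u₁ * v₂ + u * (Z * Z * v + π * (Z * Z) * v)
      ≈⟨ solve 7 (λ Z π Q u u₁ v v₂ →
           Q :* u₁ :* v₂ :+ u :* (Z :* Z :* v :+ π :* (Z :* Z) :* v)
           := (Z :* Z :+ π :* (Z :* Z)) :* (u :* v) :+ Q :* (u₁ :* v₂))
           refl Z π Q u u₁ v v₂ ⟩
    (Z * Z + π * (Z * Z)) * (u * v) + Q * (u₁ * v₂) ∎

  product-equation₂ : ∀ Z π L {e e₁ w w₁} → e ≈ L * e₁ + π * (Z * Z) * e → w ≈ w₁ + Z * w →
    e * w + π * (Z * Z * Z * Z) * (e * w)
      ≈ (Z * Z + π * (Z * Z)) * (e * w) + (1# + Z) * L * (e₁ * w₁)
  product-equation₂ Z π L {e} {e₁} {w} {w₁} ee ew = +-cancelʳ (Z * x + π * (Z * Z * Z) * x) _ _ (begin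
    x + π * (Z * Z * Z * Z) * x + (Z * x + π * (Z * Z * Z) * x)
      ≈⟨ solve 3 (λ Z π x → x :+ π :* (Z :* Z :* Z :* Z) :* x :+ (Z :* x :+ π :* (Z :* Z :* Z) :* x)
           := (con 1 :+ Z) :* (x :+ π :* (Z :* Z :* Z) :* x)) refl Z π x ⟩
    (1# + Z) * (x + π * (Z * Z * Z) * x)
      ≈⟨ *-congˡ main ⟨
    (1# + Z) * (y + π * (Z * Z) * x + Z * x)
      ≈⟨ solve 5 (λ Z π L x t → (con 1 :+ Z) :* (L :* t :+ π :* (Z :* Z) :* x :+ Z :* x)
           := (Z :* Z :+ π :* (Z :* Z)) :* x :+ (con 1 :+ Z) :* L :* t
              :+ (Z :* x :+ π :* (Z :* Z :* Z) :* x)) refl Z π L x (e₁ * w₁) ⟩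
    (Z * Z + π * (Z * Z)) * x + (1# + Z) * L * (e₁ * w₁) + (Z * x + π * (Z * Z * Z) * x) ∎)
    where
    x y : Carrier
    x = e * w
    y = L * (e₁ * w₁)
    x≈ : x ≈ e * w₁ + Z * x
    x≈ = trans (*-congˡ ew)
      (solve 4 (λ Z e w w₁ → e :* (w₁ :+ Z :* w) := e :* w₁ :+ Z :* (e :* w)) refl Z e w w₁)
    ew₁≈ : e * w₁ ≈ y + π * (Z * Z) * (e * w₁)
    ew₁≈ = trans (*-congʳ ee)
      (solve 6 (λ Z π L e e₁ w₁ → (L :* e₁ :+ π :* (Z :* Z) :* e) :* w₁
         := L :* (e₁ :* w₁) :+ π :* (Z :* Z) :* (e :* w₁)) refl Z π L e e₁ w₁)
    -- This is (1 - Z)(1 - πZ²)x = y; the factor 1 + Z applied above turns 1 - Z into 1 - Z².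
    main : y + π * (Z * Z) * x + Z * x ≈ x + π * (Z * Z * Z) * x
    main = begin
      y + π * (Z * Z) * x + Z * x
        ≈⟨ +-congʳ (+-congˡ (*-congˡ x≈)) ⟩
      y + π * (Z * Z) * (e * w₁ + Z * x) + Z * x
        ≈⟨ solve 5 (λ Z π x y t → y :+ π :* (Z :* Z) :* (t :+ Z :* x) :+ Z :* x
             := (y :+ π :* (Z :* Z) :* t) :+ Z :* x :+ π :* (Z :* Z :* Z) :* x) refl Z π x y (e * w₁) ⟩
      (y + π * (Z * Z) * (e * w₁)) + Z * x + π * (Z * Z * Z) * x
        ≈⟨ +-congʳ (+-congʳ ew₁≈) ⟨
      e * w₁ + Z * x + π * (Z * Z * Z) * x
        ≈⟨ +-congʳ x≈ ⟨
      x + π * (Z * Z * Z) * x ∎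

  -- Adding the last two hypotheses gives (1 - P₂)(X₂ + Y₂) = P₁(aX₁ + bY₁). After multiplication by
  -- 1 + P₁, one copy of aX₁ + bY₁ is kept and the other is rewritten by the first two hypotheses,
  -- which swap X and Y. The cross terms then complete (a + b)(X₁ + Y₁), and X₀, Y₀ enter only
  -- through their sum.
  sum-recurrence : ∀ a b {P₀ P₁ P₂ X₀ X₁ X₂ Y₀ Y₁ Y₂} →
    X₁ ≈ P₁ * Y₁ + b * (P₀ * Y₀) → Y₁ ≈ P₁ * X₁ + a * (P₀ * X₀) →
    X₂ ≈ P₂ * Y₂ + b * (P₁ * Y₁) → Y₂ ≈ P₂ * X₂ + a * (P₁ * X₁) →
    (X₂ + Y₂) * (1# + P₁) ≈ P₂ * ((X₂ + Y₂) * (1# + P₁))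
      + (P₁ * P₁ * (a + b) * (X₁ + Y₁) + a * b * P₁ * P₀ * (X₀ + Y₀))
  sum-recurrence a b {P₀} {P₁} {P₂} {X₀} {X₁} {X₂} {Y₀} {Y₁} {Y₂} eX₁ eY₁ eX₂ eY₂ = begin
    (X₂ + Y₂) * (1# + P₁)
      ≈⟨ *-congʳ (+-cong eX₂ eY₂) ⟩
    (P₂ * Y₂ + b * (P₁ * Y₁) + (P₂ * X₂ + a * (P₁ * X₁))) * (1# + P₁)
      ≈⟨ solve 8 (λ a b P₁ P₂ X₁ X₂ Y₁ Y₂ →
           (P₂ :* Y₂ :+ b :* (P₁ :* Y₁) :+ (P₂ :* X₂ :+ a :* (P₁ :* X₁))) :* (con 1 :+ P₁)
           := (P₂ :* ((X₂ :+ Y₂) :* (con 1 :+ P₁)) :+ P₁ :* P₁ :* (b :* Y₁ :+ a :* X₁))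
              :+ P₁ :* (b :* Y₁ :+ a :* X₁))
           refl a b P₁ P₂ X₁ X₂ Y₁ Y₂ ⟩
    (P₂ * ((X₂ + Y₂) * (1# + P₁)) + P₁ * P₁ * (b * Y₁ + a * X₁)) + P₁ * (b * Y₁ + a * X₁)
      ≈⟨ +-congˡ (*-congˡ (+-cong (*-congˡ eY₁) (*-congˡ eX₁))) ⟩
    (P₂ * ((X₂ + Y₂) * (1# + P₁)) + P₁ * P₁ * (b * Y₁ + a * X₁))
      + P₁ * (b * (P₁ * X₁ + a * (P₀ * X₀)) + a * (P₁ * Y₁ + b * (P₀ * Y₀)))
      ≈⟨ solve 9 (λ a b P₀ P₁ D X₀ X₁ Y₀ Y₁ →
           (D :+ P₁ :* P₁ :* (b :* Y₁ :+ a :* X₁))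
             :+ P₁ :* (b :* (P₁ :* X₁ :+ a :* (P₀ :* X₀)) :+ a :* (P₁ :* Y₁ :+ b :* (P₀ :* Y₀)))
           := D :+ (P₁ :* P₁ :* (a :+ b) :* (X₁ :+ Y₁) :+ a :* b :* P₁ :* P₀ :* (X₀ :+ Y₀)))
           refl a b P₀ P₁ (P₂ * ((X₂ + Y₂) * (1# + P₁))) X₀ X₁ Y₀ Y₁ ⟩
    P₂ * ((X₂ + Y₂) * (1# + P₁))
      + (P₁ * P₁ * (a + b) * (X₁ + Y₁) + a * b * P₁ * P₀ * (X₀ + Y₀)) ∎

-- Triangular numbers.

tri : ℕ → ℕ
tri zero    = 0
tri (suc n) = n ℕ.+ tri n

-- Splits the weight p^{tri(s+n)} into p^{tri s}, (p^s)^n and p^{tri n}, so that summing over n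
-- becomes an evaluation at z = p^s.
tri-+ : ∀ m n → tri (m ℕ.+ n) ≡ tri m ℕ.+ (m ℕ.* n ℕ.+ tri n)
tri-+ zero    n = ≡.refl
tri-+ (suc m) n = ≡.trans (≡.cong (m ℕ.+ n ℕ.+_) (tri-+ m n))
  (solve 5 (λ m n t x u → m :+ n :+ (t :+ (x :+ u)) := m :+ t :+ (n :+ x :+ u)) ≡.refl
    m n (tri m) (m ℕ.* n) (tri n))
  where open ℕSolver

-- Justifies the cutoff n + 2: terms weighted by p^{tri k} with k ≥ n + 2 cannot reach the
-- coefficient of q^n.
tri-lower : ∀ {n} k → 2 ℕ.+ n ℕ.≤ k → n ℕ.< tri k
tri-lower (suc k) (ℕ.s≤s n<k) = ℕₚ.≤-trans n<k (ℕₚ.m≤m+n k (tri k))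

2*tri+n≡n² : ∀ n → 2 ℕ.* tri n ℕ.+ n ≡ n ℕ.* n
2*tri+n≡n² zero    = ≡.refl
2*tri+n≡n² (suc n) = ≡.trans
  (solve 2 (λ n t → con 2 :* (n :+ t) :+ (con 1 :+ n) := (con 2 :* t :+ n) :+ (con 2 :* n :+ con 1)) ≡.refl n (tri n))
  (≡.trans (≡.cong (ℕ._+ (2 ℕ.* n ℕ.+ 1)) (2*tri+n≡n² n))
  (solve 1 (λ n → n :* n :+ (con 2 :* n :+ con 1) := (con 1 :+ n) :* (con 1 :+ n)) ≡.refl n))
  where open ℕSolver

-- g k = 1/(1 - q^k) for k ≥ 1; nothing is required of g 0.
Geometric : {c ℓ : Level} (R : CommutativeRing c ℓ) →
            CommutativeRing.Carrier R → (ℕ → CommutativeRing.Carrier R) → Set ℓ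
Geometric R q g = ∀ k → g (suc k) ≈ 1# + q ^ suc k * g (suc k)
  where
  open CommutativeRing R
  open Exp commutativeSemiring

-- Generating functions in z and their functional equations.

module Coefficients {c ℓ : Level} (R : CommutativeRing c ℓ) (q : CommutativeRing.Carrier R)
  (g : ℕ → CommutativeRing.Carrier R) (g-geom : Geometric R q g) where

  open CommutativeRing R
  open Exp commutativeSemiring
  open Series R public
  open RingLemmas R
  open SetoidReasoning setoid
  open Solver commutativeSemiring using (solve; _:=_; _:+_; _:*_; con)
  private
    module A = CommutativeRing seriesRing
    module AL = RingLemmas seriesRing

  const : Carrier → Seq
  const c zero    = c
  const c (suc _) = 0#

  Z : Seq
  Z zero    = 0#
  Z (suc n) = δ n

  -- 1 + c z
  lin : Carrier → Seq
  lin c zero    = 1#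
  lin c (suc n) = const c n

  const-⋆ : ∀ c f n → (const c ⋆ f) n ≈ c * f n
  const-⋆ c f zero    = refl
  const-⋆ c f (suc n) = trans (+-congˡ (⋆-zeroˡ f (λ _ → refl) n)) (+-identityʳ _)

  lin-⋆-zero : ∀ c f → (lin c ⋆ f) 0 ≈ f 0
  lin-⋆-zero c f = *-identityˡ _

  lin-⋆-suc : ∀ c f n → (lin c ⋆ f) (suc n) ≈ f (suc n) + c * f n
  lin-⋆-suc c f n = +-cong (*-identityˡ _) (const-⋆ c f n)

  lin-1 : A.1# A.+ Z ≋ lin 1#
  lin-1 zero          = +-identityʳ _
  lin-1 (suc zero)    = +-identityˡ _
  lin-1 (suc (suc n)) = +-identityˡ _

  up : Seq → Seq
  up f zero    = 0#
  up f (suc n) = f n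

  Z-⋆ : ∀ f → Z ⋆ f ≋ up f
  Z-⋆ f zero    = zeroˡ _
  Z-⋆ f (suc n) = trans (+-cong (zeroˡ _) (⋆-identityˡ f n)) (+-identityˡ _)

  up-cong : ∀ {f g} → f ≋ g → up f ≋ up g
  up-cong e zero    = refl
  up-cong e (suc n) = e n

  ZZ-⋆ : ∀ f → (Z ⋆ Z) ⋆ f ≋ up (up f)
  ZZ-⋆ f n = trans (⋆-assoc Z Z f n) (trans (Z-⋆ (Z ⋆ f) n) (up-cong (Z-⋆ f) n))

  -- Coefficients of f(z²).
  spread : Seq → Seq
  spread f zero          = f 0
  spread f (suc zero)    = 0#
  spread f (suc (suc n)) = spread (f ∘ suc) n

  spread-cong : ∀ {f g} → f ≋ g → spread f ≋ spread g
  spread-cong e zero          = e 0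
  spread-cong e (suc zero)    = refl
  spread-cong e (suc (suc n)) = spread-cong (e ∘ suc) n

  spread-+ : ∀ f g n → spread (λ k → f k + g k) n ≈ spread f n + spread g n
  spread-+ f g zero          = refl
  spread-+ f g (suc zero)    = sym (+-identityˡ _)
  spread-+ f g (suc (suc n)) = spread-+ (f ∘ suc) (g ∘ suc) n

  spread-weight : ∀ (w f : Seq) n → w n * spread f n ≈ spread (λ k → w (k ℕ.+ k) * f k) n
  spread-weight w f zero          = refl
  spread-weight w f (suc zero)    = zeroʳ _
  spread-weight w f (suc (suc n)) = trans (spread-weight (w ∘ suc ∘ suc) (f ∘ suc) n)
    (spread-cong (λ k → *-congʳ (reflexive (≡.cong (w ∘ suc) (≡.sym (ℕₚ.+-suc k k))))) n)

  spread-even : ∀ f n → spread f (n ℕ.+ n) ≈ f n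
  spread-even f zero    = refl
  spread-even f (suc n) rewrite ℕₚ.+-suc n n = spread-even (f ∘ suc) n

  spread-odd : ∀ f n → spread f (suc (n ℕ.+ n)) ≈ 0#
  spread-odd f zero    = refl
  spread-odd f (suc n) rewrite ℕₚ.+-suc n n = spread-odd (f ∘ suc) n

  -- The relation f(z) = g(z) + z h(z) with z² substituted for z.
  spread-step : ∀ {f g h} → f 0 ≈ g 0 → (∀ n → f (suc n) ≈ g (suc n) + h n) →
                spread f ≋ λ n → spread g n + up (up (spread h)) n
  spread-step e₀ e zero          = trans e₀ (sym (+-identityʳ _))
  spread-step e₀ e (suc zero)    = sym (+-identityʳ _)
  spread-step e₀ e (suc (suc n)) = trans (spread-cong e n) (spread-+ _ _ n)

  p a b : Carrier
  p = q ^ 3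
  a = q ^ 1
  b = q ^ 2

  ab≈p : a * b ≈ p
  ab≈p = sym (^-homo-* q 1 2)

  g₃-geom : ∀ n → g (3 ℕ.* suc n) ≈ 1# + p ^ suc n * g (3 ℕ.* suc n)
  g₃-geom n = trans (g-geom _) (+-congˡ (*-congʳ (sym (^-assocʳ q 3 (suc n)))))

  -- Supplies the inverse of 1 - p^{2(n+1)}, the determinant of the coupled recurrences for `X` and
  -- `Y`.
  g₆-geom : ∀ n → g (6 ℕ.* suc n) ≈ 1# + (p ^ suc n * p ^ suc n) * g (6 ℕ.* suc n)
  g₆-geom n = trans (g-geom _) (+-congˡ (*-congʳ (begin
    q ^ (6 ℕ.* suc n)                    ≡⟨ ≡.cong (q ^_) (ℕₚ.*-distribʳ-+ (suc n) 3 3) ⟩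
    q ^ (3 ℕ.* suc n ℕ.+ 3 ℕ.* suc n)    ≈⟨ ^-homo-* q (3 ℕ.* suc n) (3 ℕ.* suc n) ⟩
    q ^ (3 ℕ.* suc n) * q ^ (3 ℕ.* suc n)
      ≈⟨ *-cong (^-assocʳ q 3 (suc n)) (^-assocʳ q 3 (suc n)) ⟨
    p ^ suc n * p ^ suc n ∎)))

  -- The equation is (1 + K - H)f(z) = Q f(pz). Since K and H have no constant term and Q has
  -- constant term 1, its coefficient at n + 1 expresses (1 - p^{n+1}) f_{n+1} through earlier
  -- coefficients, and 1 - p^{n+1} is invertible.
  unique-solution : ∀ {K H Q f f′} → K 0 ≈ 0# → H 0 ≈ 0# → Q 0 ≈ 1# → f 0 ≈ f′ 0 →
    (∀ n → f n + (K ⋆ f) n ≈ (H ⋆ f) n + (Q ⋆ scale p f) n) →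
    (∀ n → f′ n + (K ⋆ f′) n ≈ (H ⋆ f′) n + (Q ⋆ scale p f′) n) →
    f ≋ f′
  unique-solution {K} {H} {Q} {f} {f′} K₀ H₀ Q₀ e₀ ef ef′ = <-rec _ step
    where
    agree : ∀ P {h h′} n → (∀ {k} → k ℕ.≤ n → h k ≈ h′ k) → (P ⋆ h) n ≈ (P ⋆ h′) n
    agree P zero    e = *-congˡ (e ℕ.z≤n)
    agree P (suc n) e = +-cong (*-congˡ (e ℕₚ.≤-refl)) (agree (P ∘ suc) n (λ k≤n → e (ℕₚ.m≤n⇒m≤1+n k≤n)))

    tidy : ∀ n h {rK rH rQ} →
      h (suc n) + (K 0 * h (suc n) + rK)
        ≈ (H 0 * h (suc n) + rH) + (Q 0 * scale p h (suc n) + rQ) →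
      h (suc n) + rK ≈ p ^ suc n * h (suc n) + (rH + rQ)
    tidy n h {rK} {rH} {rQ} eq = begin
      h (suc n) + rK
        ≈⟨ +-congˡ (trans (+-congʳ (trans (*-congʳ K₀) (zeroˡ _))) (+-identityˡ _)) ⟨
      h (suc n) + (K 0 * h (suc n) + rK)  ≈⟨ eq ⟩
      (H 0 * h (suc n) + rH) + (Q 0 * scale p h (suc n) + rQ)
        ≈⟨ +-cong (trans (+-congʳ (trans (*-congʳ H₀) (zeroˡ _))) (+-identityˡ _))
                  (+-congʳ (trans (*-congʳ Q₀) (*-identityˡ _))) ⟩
      rH + (scale p h (suc n) + rQ)
        ≈⟨ solve 3 (λ x y z → x :+ (y :+ z) := y :+ (x :+ z)) refl _ _ _ ⟩
      p ^ suc n * h (suc n) + (rH + rQ) ∎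

    step : ∀ n → (∀ {k} → k ℕ.< n → f k ≈ f′ k) → f n ≈ f′ n
    step zero    _  = e₀
    step (suc n) ih = geom-unique (g₃-geom n) (tidy n f (ef (suc n)))
      (trans (+-congˡ (agree (K ∘ suc) n below)) (trans (tidy n f′ (ef′ (suc n)))
        (sym (+-congˡ (+-cong (agree (H ∘ suc) n below)
          (agree (Q ∘ suc) n (λ k≤n → *-congˡ (below k≤n))))))))
      where
      below : ∀ {k} → k ℕ.≤ n → f k ≈ f′ k
      below k≤n = ih (ℕ.s≤s k≤n)

  -- 1/(q^d;q^d)_n
  invPochhammer : ℕ → Seq
  invPochhammer d zero    = 1#
  invPochhammer d (suc n) = invPochhammer d n * g (d ℕ.* suc n)

  -- Generating functions in z: u = (-z;q)_∞, v = 1/(z²;p)_∞, w = 1/(z;p)_∞, and e is e(z).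
  u v w e : Seq
  u n = q ^ tri n * invPochhammer 1 n
  w = invPochhammer 3
  v = spread w
  e zero          = 1#
  e (suc zero)    = g 3 * (a + b)
  e (suc (suc s)) = g (3 ℕ.* suc (suc s)) *
    ((a + b) * (p ^ suc s * e (suc s)) + a * b * ((1# + p ^ s) * e s))

  w-suc : ∀ n → w (suc n) ≈ p ^ suc n * w (suc n) + w n
  w-suc n = trans (*-comm _ _) (trans (geom-solves (w n) (g₃-geom n)) (+-congʳ (*-congˡ (*-comm _ _))))

  -- The coefficients of (1 + z)(1 + tz)(1 + t²z)⋯ are t^tri n / (t;t)_n.
  euler-suc : ∀ t (i : Seq) n → i (suc n) ≈ t ^ suc n * i (suc n) + i n →
    t ^ tri (suc n) * i (suc n) ≈ t ^ suc n * (t ^ tri (suc n) * i (suc n)) + 1# * (t ^ n * (t ^ tri n * i n))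
  euler-suc t i n ei = begin
    T * i (suc n)                          ≈⟨ *-congˡ ei ⟩
    T * (t ^ suc n * i (suc n) + i n)
      ≈⟨ solve 4 (λ T P x y → T :* (P :* x :+ y) := P :* (T :* x) :+ T :* y) refl T (t ^ suc n) (i (suc n)) (i n) ⟩
    t ^ suc n * (T * i (suc n)) + T * i n
      ≈⟨ +-congˡ (trans (*-congʳ (^-homo-* t n (tri n)))
           (solve 3 (λ x y z → x :* y :* z := con 1 :* (x :* (y :* z))) refl _ _ _)) ⟩
    t ^ suc n * (T * i (suc n)) + 1# * (t ^ n * (t ^ tri n * i n)) ∎
    where
    T : Carrier
    T = t ^ tri (suc n)

  -- For positive coefficients, f(z) = (1 + cz)h(tz) turns into f(rz) = (1 + crz)h(trz).
  dilate : ∀ t r c (f h : Seq) n → f (suc n) ≈ t ^ suc n * h (suc n) + c * (t ^ n * h n) →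
    r ^ suc n * f (suc n) ≈ (t * r) ^ suc n * h (suc n) + (c * r) * ((t * r) ^ n * h n)
  dilate t r c f h n ef = begin
    r ^ suc n * f (suc n)                                      ≈⟨ *-congˡ ef ⟩
    r ^ suc n * (t ^ suc n * h (suc n) + c * (t ^ n * h n))
      ≈⟨ solve 7 (λ r R T c x y z → (r :* R) :* (T :* x :+ c :* (y :* z))
           := (T :* (r :* R)) :* x :+ (c :* r) :* ((y :* R) :* z))
           refl r (r ^ n) (t ^ suc n) c (h (suc n)) (t ^ n) (h n) ⟩
    (t ^ suc n * r ^ suc n) * h (suc n) + (c * r) * ((t ^ n * r ^ n) * h n)
      ≈⟨ +-cong (*-congʳ (^-distrib-* t r (suc n))) (*-congˡ (*-congʳ (^-distrib-* t r n))) ⟨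
    (t * r) ^ suc n * h (suc n) + (c * r) * ((t * r) ^ n * h n) ∎

  u-suc : ∀ n → u (suc n) ≈ q ^ suc n * u (suc n) + 1# * (q ^ n * u n)
  u-suc n = euler-suc q (invPochhammer 1) n (trans (*-comm _ _)
    (trans (geom-solves (invPochhammer 1 n) geom₁) (+-congʳ (*-congˡ (*-comm _ _)))))
    where
    geom₁ : g (1 ℕ.* suc n) ≈ 1# + q ^ suc n * g (1 ℕ.* suc n)
    geom₁ = trans (g-geom _) (+-congˡ (*-congʳ (reflexive (≡.cong (q ^_) (ℕₚ.*-identityˡ (suc n))))))

  u-dilate : ∀ j → scale (q ^ j) u ≋ lin (q ^ j) ⋆ scale (q ^ suc j) u
  u-dilate j zero    = sym (lin-⋆-zero (q ^ j) (scale (q ^ suc j) u))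
  u-dilate j (suc n) = trans (dilate q (q ^ j) 1# u u n (u-suc n))
    (trans (+-congˡ (*-congʳ (*-identityˡ _))) (sym (lin-⋆-suc (q ^ j) (scale (q ^ suc j) u) n)))

  -- The coefficients of (-z;p)_∞.
  y : Seq
  y n = p ^ tri n * w n

  y-suc : ∀ n → y (suc n) ≈ p ^ suc n * y (suc n) + 1# * (p ^ n * y n)
  y-suc n = euler-suc p w n (w-suc n)

  1^n≈1 : ∀ n → 1# ^ n ≈ 1#
  1^n≈1 zero    = refl
  1^n≈1 (suc n) = trans (*-identityˡ _) (1^n≈1 n)

  L Q π : Seq
  L = lin a ⋆ lin b
  Q = (A.1# A.+ Z) ⋆ L
  π = const p

  -- Three dilations by q strip the factors 1 + z, 1 + qz and 1 + q²z from (-z;q)_∞ and leave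
  -- (-pz;q)_∞.
  u-equation : u ≋ Q ⋆ scale p u
  u-equation = A.trans (λ n → sym (trans (*-congʳ (1^n≈1 n)) (*-identityˡ _)))
    (A.trans (u-dilate 0) (A.trans (A.*-cong (A.sym lin-1)
      (A.trans (u-dilate 1) (A.trans (A.*-congˡ {lin a} (u-dilate 2)) (A.sym (A.*-assoc (lin a) (lin b) _)))))
      (A.sym (A.*-assoc _ L _))))

  -- The series 1/(pz²;p)_∞, halfway from v(z) to v(pz) = 1/(p²z²;p)_∞: replacing z by pz removes
  -- two factors.
  v₁ : Seq
  v₁ = spread (λ n → p ^ n * w n)

  v-equation : v ≋ λ n → v₁ n + ((Z ⋆ Z) ⋆ v) n
  v-equation n = trans
    (spread-step {w} {λ n → p ^ n * w n} {w} (sym (*-identityˡ _)) w-suc n) (+-congˡ (sym (ZZ-⋆ v n)))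

  v₁-equation : v₁ ≋ λ n → scale p v n + ((π ⋆ (Z ⋆ Z)) ⋆ v₁) n
  v₁-equation n = trans (spread-step {h = λ n → p * (p ^ n * w n)} refl step n)
    (+-cong (sym (spread-weight (p ^_) w n)) (sym (begin
      ((π ⋆ (Z ⋆ Z)) ⋆ v₁) n   ≈⟨ trans (⋆-assoc π (Z ⋆ Z) v₁ n) (const-⋆ p _ n) ⟩
      p * ((Z ⋆ Z) ⋆ v₁) n     ≈⟨ *-congˡ (ZZ-⋆ v₁ n) ⟩
      p * up (up v₁) n         ≈⟨ up-* (up v₁) n ⟩
      up (λ k → p * up v₁ k) n ≈⟨ up-cong (up-* v₁) n ⟩
      up (up (λ k → p * v₁ k)) n ≈⟨ up-cong (up-cong (spread-weight (λ _ → p) _)) n ⟩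
      up (up (spread (λ k → p * (p ^ k * w k)))) n ∎)))
    where
    up-* : ∀ f n → p * up f n ≈ up (λ k → p * f k) n
    up-* f zero    = zeroʳ _
    up-* f (suc n) = refl
    step : ∀ n → p ^ suc n * w (suc n) ≈ p ^ (suc n ℕ.+ suc n) * w (suc n) + p * (p ^ n * w n)
    step n = begin
      p ^ suc n * w (suc n)                              ≈⟨ *-congˡ (w-suc n) ⟩
      p ^ suc n * (p ^ suc n * w (suc n) + w n)
        ≈⟨ solve 4 (λ p x y z → (p :* x) :* ((p :* x) :* y :+ z)
             := (p :* x :* (p :* x)) :* y :+ p :* (x :* z)) refl p (p ^ n) (w (suc n)) (w n) ⟩
      p ^ suc n * p ^ suc n * w (suc n) + p * (p ^ n * w n)
        ≈⟨ +-congʳ (*-congʳ (^-homo-* p (suc n) (suc n))) ⟨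
      p ^ (suc n ℕ.+ suc n) * w (suc n) + p * (p ^ n * w n) ∎

  w-equation : w ≋ λ n → scale p w n + (Z ⋆ w) n
  w-equation zero    = sym (trans (+-cong (*-identityˡ _) (Z-⋆ w 0)) (+-identityʳ _))
  w-equation (suc n) = trans (w-suc n) (+-congˡ (sym (Z-⋆ w (suc n))))

  e-suc : ∀ s → e (suc (suc s)) ≈ p ^ suc (suc s) * e (suc (suc s)) +
    ((a + b) * (p ^ suc s * e (suc s)) + a * b * ((1# + p ^ s) * e s))
  e-suc s = geom-solves _ (g₃-geom (suc s))

  e-one : e 1 ≈ p ^ 1 * e 1 + (a + b)
  e-one = geom-solves _ (g₃-geom 0)

  -- The recurrence defining `e` is the coefficient form of (1 - abz²)e(z) = (1 + az)(1 + bz)e(pz),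
  -- with ab = p.
  e-equation : e ≋ λ n → (L ⋆ scale p e) n + ((π ⋆ (Z ⋆ Z)) ⋆ e) n
  e-equation n = trans (coefficient n) (+-cong (sym (⋆-assoc (lin a) (lin b) _ n))
    (sym (trans (⋆-assoc π (Z ⋆ Z) e n) (trans (const-⋆ p _ n) (*-congˡ (ZZ-⋆ e n))))))
    where
    coefficient : ∀ n → e n ≈ (lin a ⋆ (lin b ⋆ scale p e)) n + p * up (up e) n
    coefficient zero = sym (trans (+-cong (trans (*-identityˡ _) (trans (*-identityˡ _) (*-identityˡ _)))
      (zeroʳ _)) (+-identityʳ _))
    coefficient (suc zero) = trans e-one (sym (begin
      (lin a ⋆ (lin b ⋆ scale p e)) 1 + p * 0#
        ≈⟨ +-cong (trans (lin-⋆-suc a (lin b ⋆ scale p e) 0)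
             (+-cong (lin-⋆-suc b (scale p e) 0) (*-congˡ (lin-⋆-zero b (scale p e))))) (zeroʳ _) ⟩
      p ^ 1 * e 1 + b * (1# * 1#) + a * (1# * 1#) + 0#
        ≈⟨ solve 3 (λ x a b → x :+ b :* (con 1 :* con 1) :+ a :* (con 1 :* con 1) :+ con 0 := x :+ (a :+ b))
             refl (p ^ 1 * e 1) a b ⟩
      p ^ 1 * e 1 + (a + b) ∎))
    coefficient (suc (suc s)) = trans (e-suc s) (sym (begin
      (lin a ⋆ (lin b ⋆ scale p e)) (suc (suc s)) + p * e s
        ≈⟨ +-cong (trans (lin-⋆-suc a _ (suc s)) (+-cong (lin-⋆-suc b _ (suc s)) (*-congˡ (lin-⋆-suc b _ s))))
                  (*-congʳ (sym ab≈p)) ⟩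
      p ^ suc (suc s) * e (suc (suc s)) + b * (p ^ suc s * e (suc s))
        + a * (p ^ suc s * e (suc s) + b * (p ^ s * e s)) + a * b * e s
        ≈⟨ solve 6 (λ x y P t a b → x :+ b :* y :+ a :* (y :+ b :* (P :* t)) :+ a :* b :* t
             := x :+ ((a :+ b) :* y :+ a :* b :* ((con 1 :+ P) :* t)))
             refl (p ^ suc (suc s) * e (suc (suc s))) (p ^ suc s * e (suc s)) (p ^ s) (e s) a b ⟩
      p ^ suc (suc s) * e (suc (suc s))
        + ((a + b) * (p ^ suc s * e (suc s)) + a * b * ((1# + p ^ s) * e s)) ∎))

  -- Both sides are expressions for F(z). Each has constant term 1 and satisfies (1 - z²)(1 -
  -- pz²)f(z) = (1 + z)(1 + az)(1 + bz)f(pz), so uniqueness identifies them without manipulating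
  -- infinite products.
  u⋆v≋e⋆w : u ⋆ v ≋ e ⋆ w
  u⋆v≋e⋆w = unique-solution {π ⋆ (Z ⋆ Z ⋆ Z ⋆ Z)} {(Z ⋆ Z) A.+ (π ⋆ (Z ⋆ Z))} {Q}
    (trans (*-congˡ (zeroʳ _)) (zeroʳ _))
    (trans (+-cong (zeroʳ _) (trans (*-congˡ (zeroʳ _)) (zeroʳ _))) (+-identityʳ _))
    (trans (*-cong (+-identityʳ _) (*-identityʳ _)) (*-identityʳ _))
    (*-congʳ (*-identityʳ _))
    (A.trans (AL.product-equation₁ Z π Q {u} {scale p u} {v} {v₁} {scale p v} u-equation v-equation v₁-equation)
      (A.+-congˡ {((Z ⋆ Z) A.+ (π ⋆ (Z ⋆ Z))) ⋆ (u ⋆ v)} (A.*-congˡ {Q} (A.sym (scale-⋆ p u v)))))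
    (A.trans (AL.product-equation₂ Z π L {e} {scale p e} {w} {scale p w} e-equation w-equation)
      (A.+-congˡ {((Z ⋆ Z) A.+ (π ⋆ (Z ⋆ Z))) ⋆ (e ⋆ w)} (A.*-congˡ {Q} (A.sym (scale-⋆ p e w)))))

  -- Closed form of the weighted coefficients of e(z).

  -- X = P Y + c and Y = P X + d with P = p^{s+1} have been solved for X.
  X Y : Seq
  X zero    = 1#
  X (suc s) = g (6 ℕ.* suc s) * (p ^ suc s * (a * (p ^ s * X s)) + b * (p ^ s * Y s))
  Y zero    = 1#
  Y (suc s) = p ^ suc s * X (suc s) + a * (p ^ s * X s)

  -- Undoes the elimination of Y and restores the coefficient form of X(z) = (1 + bz)Y(pz).
  X-suc : ∀ s → X (suc s) ≈ p ^ suc s * Y (suc s) + b * (p ^ s * Y s)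
  X-suc s = trans (geom-solves _ (g₆-geom s))
    (solve 4 (λ P x y z → P :* P :* x :+ (P :* y :+ z) := P :* (P :* x :+ y) :+ z) refl _ _ _ _)

  -- G s = (-p;p)_s
  G : Seq
  G zero    = 1#
  G (suc s) = G s * (1# + p ^ suc s)

  E : Seq
  E s = p ^ tri s * e s

  -- The recurrence for `e` multiplied by p^{tri(s+2)}, where tri(s+2) = (s+1) + tri(s+1) = (s+1) +
  -- s + tri s. The factor 1 + p^s stays with E_s, in the form `E-closed` rewrites.
  E-suc : ∀ s → E (suc (suc s)) ≈ p ^ suc (suc s) * E (suc (suc s)) +
    (p ^ suc s * p ^ suc s * (a + b) * E (suc s) + a * b * p ^ suc s * p ^ s * ((1# + p ^ s) * E s))
  E-suc s = begin
    T₂ * e (suc (suc s))   ≈⟨ *-congˡ (e-suc s) ⟩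
    T₂ * (P₂ * e (suc (suc s)) + ((a + b) * (P₁ * e (suc s)) + a * b * ((1# + P₀) * e s)))
      ≈⟨ solve 9 (λ T P e₂ P₁ P₀ e₁ e₀ a b →
           T :* (P :* e₂ :+ ((a :+ b) :* (P₁ :* e₁) :+ a :* b :* ((con 1 :+ P₀) :* e₀)))
           := P :* (T :* e₂) :+ (T :* (P₁ :* (a :+ b) :* e₁) :+ T :* (a :* b :* ((con 1 :+ P₀) :* e₀))))
           refl T₂ P₂ (e (suc (suc s))) P₁ P₀ (e (suc s)) (e s) a b ⟩
    P₂ * E (suc (suc s)) + (T₂ * (P₁ * (a + b) * e (suc s)) + T₂ * (a * b * ((1# + P₀) * e s)))
      ≈⟨ +-congˡ (+-cong (*-congʳ T₂≈) (*-congʳ (trans T₂≈ (*-congˡ (^-homo-* p s (tri s)))))) ⟩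
    P₂ * E (suc (suc s)) + ((P₁ * T₁) * (P₁ * (a + b) * e (suc s)) + (P₁ * (P₀ * T₀)) * (a * b * ((1# + P₀) * e s)))
      ≈⟨ +-congˡ (solve 8 (λ P₁ P₀ T₁ T₀ e₁ e₀ a b →
           (P₁ :* T₁) :* (P₁ :* (a :+ b) :* e₁) :+ (P₁ :* (P₀ :* T₀)) :* (a :* b :* ((con 1 :+ P₀) :* e₀))
           := P₁ :* P₁ :* (a :+ b) :* (T₁ :* e₁) :+ a :* b :* P₁ :* P₀ :* ((con 1 :+ P₀) :* (T₀ :* e₀)))
           refl P₁ P₀ T₁ T₀ (e (suc s)) (e s) a b) ⟩
    P₂ * E (suc (suc s)) + (P₁ * P₁ * (a + b) * E (suc s) + a * b * P₁ * P₀ * ((1# + P₀) * E s)) ∎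
    where
    P₀ P₁ P₂ T₀ T₁ T₂ : Carrier
    P₀ = p ^ s
    P₁ = p ^ suc s
    P₂ = p ^ suc (suc s)
    T₀ = p ^ tri s
    T₁ = p ^ tri (suc s)
    T₂ = p ^ tri (suc (suc s))
    T₂≈ : T₂ ≈ P₁ * T₁
    T₂≈ = ^-homo-* p (suc s) (tri (suc s))

  -- Both sides satisfy one equation with invertible leading factor 1 - p^{s+2}: the left by
  -- `E-suc`, the right by `sum-recurrence` times G_s. The form divided by 1 + p^s starts at index
  -- 1, because at s = 0 that factor is 2; `E-closed` covers index 0 undivided.
  E-closed-suc : ∀ s → E (suc s) ≈ (X (suc s) + Y (suc s)) * G s
  E-closed : ∀ s → (1# + p ^ s) * E s ≈ (X s + Y s) * G s

  E-closed-suc zero = geom-unique₀ (g₃-geom 0) E₁ D₁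
    where
    E₁ : E 1 ≈ p ^ 1 * E 1 + (a + b)
    E₁ = trans (*-identityˡ _) (trans e-one (+-congʳ (*-congˡ (sym (*-identityˡ _)))))
    D₁ : (X 1 + Y 1) * 1# ≈ p ^ 1 * ((X 1 + Y 1) * 1#) + (a + b)
    D₁ = trans (*-congʳ (+-congʳ (X-suc 0)))
      (solve 5 (λ P x y a b → (P :* y :+ b :* (con 1 :* con 1) :+ (P :* x :+ a :* (con 1 :* con 1))) :* con 1
         := P :* ((x :+ y) :* con 1) :+ (a :+ b)) refl (p ^ 1) (X 1) (Y 1) a b)
  E-closed-suc (suc s) = geom-unique₀ (g₃-geom (suc s))
    (trans (E-suc s) (+-congˡ (+-cong (*-congˡ (E-closed-suc s)) (*-congˡ (E-closed s)))))
    (begin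
      D₂ * (G s * (1# + P₁))
        ≈⟨ solve 3 (λ D G P → D :* (G :* P) := D :* P :* G) refl _ _ _ ⟩
      D₂ * (1# + P₁) * G s
        ≈⟨ *-congʳ (sum-recurrence a b (X-suc s) refl (X-suc (suc s)) refl) ⟩
      (P₂ * (D₂ * (1# + P₁)) + (P₁ * P₁ * (a + b) * D₁ + a * b * P₁ * P₀ * D₀)) * G s
        ≈⟨ solve 9 (λ P₂ D₂ P₁ P₀ D₁ D₀ G a b →
             (P₂ :* (D₂ :* (con 1 :+ P₁)) :+ (P₁ :* P₁ :* (a :+ b) :* D₁ :+ a :* b :* P₁ :* P₀ :* D₀)) :* G
             := P₂ :* (D₂ :* (G :* (con 1 :+ P₁)))
                :+ (P₁ :* P₁ :* (a :+ b) :* (D₁ :* G) :+ a :* b :* P₁ :* P₀ :* (D₀ :* G)))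
             refl P₂ D₂ P₁ P₀ D₁ D₀ (G s) a b ⟩
      P₂ * (D₂ * (G s * (1# + P₁)))
        + (P₁ * P₁ * (a + b) * (D₁ * G s) + a * b * P₁ * P₀ * (D₀ * G s)) ∎)
    where
    P₀ P₁ P₂ D₀ D₁ D₂ : Carrier
    P₀ = p ^ s
    P₁ = p ^ suc s
    P₂ = p ^ suc (suc s)
    D₀ = X s + Y s
    D₁ = X (suc s) + Y (suc s)
    D₂ = X (suc (suc s)) + Y (suc (suc s))

  E-closed zero    = *-congˡ (*-identityˡ _)
  E-closed (suc s) = trans (*-congˡ (E-closed-suc s))
    (solve 3 (λ P D G → P :* (D :* G) := D :* (G :* P)) refl _ _ _)

  E-y-term : ∀ s n → p ^ tri (s ℕ.+ n) * (e s * w n) ≈ E s * ((p ^ s) ^ n * y n)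
  E-y-term s n = begin
    p ^ tri (s ℕ.+ n) * (e s * w n)
      ≡⟨ ≡.cong (λ k → p ^ k * (e s * w n)) (tri-+ s n) ⟩
    p ^ (tri s ℕ.+ (s ℕ.* n ℕ.+ tri n)) * (e s * w n)
      ≈⟨ *-congʳ (trans (^-homo-* p (tri s) _) (*-congˡ (trans (^-homo-* p (s ℕ.* n) (tri n))
           (*-congʳ (sym (^-assocʳ p s n)))))) ⟩
    p ^ tri s * ((p ^ s) ^ n * p ^ tri n) * (e s * w n)
      ≈⟨ solve 5 (λ a b c x y → a :* (b :* c) :* (x :* y) := (a :* x) :* (b :* (c :* y))) refl _ _ _ _ _ ⟩
    E s * ((p ^ s) ^ n * y n) ∎

-- Finite sums of integers.

module ℤSeries = Series ℤₚ.+-*-commutativeRing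
open ℤSeries using () renaming (diag to diagℤ)

Σ<-cong : ∀ n {f g} → (∀ k → f k ≡ g k) → Σ< n f ≡ Σ< n g
Σ<-cong zero    e = ≡.refl
Σ<-cong (suc n) e = ≡.cong₂ _+ℤ_ (Σ<-cong n e) (e n)

Σ<-zero : ∀ n {f} → (∀ k → f k ≡ 0ℤ) → Σ< n f ≡ 0ℤ
Σ<-zero zero    e = ≡.refl
Σ<-zero (suc n) e = ≡.cong₂ _+ℤ_ (Σ<-zero n e) (e n)

Σ<-head : ∀ n f → Σ< (suc n) f ≡ f 0 +ℤ Σ< n (f ∘ suc)
Σ<-head zero    f = ℤₚ.+-comm 0ℤ (f 0)
Σ<-head (suc n) f = ≡.trans (≡.cong (_+ℤ f (suc n)) (Σ<-head n f)) (ℤₚ.+-assoc (f 0) _ _)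

Σ<-+ : ∀ n f g → Σ< n (λ k → f k +ℤ g k) ≡ Σ< n f +ℤ Σ< n g
Σ<-+ zero    f g = ≡.refl
Σ<-+ (suc n) f g = ≡.trans (≡.cong (_+ℤ (f n +ℤ g n)) (Σ<-+ n f g))
  (solve 4 (λ a b x y → a :+ b :+ (x :+ y) := a :+ x :+ (b :+ y)) ≡.refl (Σ< n f) (Σ< n g) (f n) (g n))
  where open Solver ℤₚ.+-*-commutativeSemiring

Σ<-*ˡ : ∀ n c f → Σ< n (λ k → c *ℤ f k) ≡ c *ℤ Σ< n f
Σ<-*ˡ zero    c f = ≡.sym (ℤₚ.*-zeroʳ c)
Σ<-*ˡ (suc n) c f = ≡.trans (≡.cong (_+ℤ c *ℤ f n) (Σ<-*ˡ n c f))
  (≡.sym (ℤₚ.*-distribˡ-+ c _ _))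

Σ<-swap : ∀ m n (f : ℕ → ℕ → ℤ) → Σ< m (λ i → Σ< n (f i)) ≡ Σ< n (λ j → Σ< m (λ i → f i j))
Σ<-swap zero    n f = ≡.sym (Σ<-zero n (λ _ → ≡.refl))
Σ<-swap (suc m) n f = ≡.trans (≡.cong (_+ℤ Σ< n (f m)) (Σ<-swap m n f)) (≡.sym (Σ<-+ n _ _))

Σ<-extend : ∀ {m n f} → m ℕ.≤ n → (∀ k → m ℕ.≤ k → f k ≡ 0ℤ) → Σ< m f ≡ Σ< n f
Σ<-extend {n = n} {f} ℕ.z≤n e = ≡.sym (Σ<-zero n (λ k → e k ℕ.z≤n))
Σ<-extend {suc m} {suc n} {f} (ℕ.s≤s m≤n) e = ≡.trans (Σ<-head m f)
  (≡.trans (≡.cong (f 0 +ℤ_) (Σ<-extend m≤n (λ k m≤k → e (suc k) (ℕ.s≤s m≤k))))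
  (≡.sym (Σ<-head n f)))

Σ<-even : ∀ n f → (∀ k → f (suc (k ℕ.+ k)) ≡ 0ℤ) → Σ< (n ℕ.+ n) f ≡ Σ< n (λ k → f (k ℕ.+ k))
Σ<-even zero    f e = ≡.refl
Σ<-even (suc n) f e rewrite ℕₚ.+-suc n n =
  ≡.trans (≡.cong₂ _+ℤ_ (≡.cong (_+ℤ f (n ℕ.+ n)) (Σ<-even n f e)) (e n)) (ℤₚ.+-identityʳ _)

-- Rows are peeled off one at a time. The triangle i + j < B fits into the rectangle because B ≤ B′,
-- and `H` vanishes on the rest of it.
Σ<-diag : ∀ B {B′} (H : ℕ → ℕ → ℤ) → B ℕ.≤ B′ → (∀ i j → B ℕ.≤ i ℕ.+ j → H i j ≡ 0ℤ) →
          Σ< B (diagℤ H) ≡ Σ< B (λ i → Σ< B′ (H i))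
Σ<-diag zero    H _ _ = ≡.refl
Σ<-diag (suc B) {B′} H B<B′ e = begin
  Σ< (suc B) (diagℤ H)                                   ≡⟨ Σ<-head B (diagℤ H) ⟩
  H 0 0 +ℤ Σ< B (λ k → H 0 (suc k) +ℤ diagℤ (H ∘ suc) k)
    ≡⟨ ≡.cong (H 0 0 +ℤ_) (Σ<-+ B (H 0 ∘ suc) (diagℤ (H ∘ suc))) ⟩
  H 0 0 +ℤ (Σ< B (H 0 ∘ suc) +ℤ Σ< B (diagℤ (H ∘ suc))) ≡⟨ ℤₚ.+-assoc (H 0 0) _ _ ⟨
  H 0 0 +ℤ Σ< B (H 0 ∘ suc) +ℤ Σ< B (diagℤ (H ∘ suc))
    ≡⟨ ≡.cong₂ _+ℤ_ (≡.trans (≡.sym (Σ<-head B (H 0))) (Σ<-extend B<B′ (e 0)))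
         (Σ<-diag B (H ∘ suc) (ℕₚ.<⇒≤ B<B′) (λ i j B≤ → e (suc i) j (ℕ.s≤s B≤))) ⟩
  Σ< B′ (H 0) +ℤ Σ< B (λ i → Σ< B′ (H (suc i)))         ≡⟨ Σ<-head B (λ i → Σ< B′ (H i)) ⟨
  Σ< (suc B) (λ i → Σ< B′ (H i))                         ∎
  where open ≡.≡-Reasoning

diagℤ-cong-at : ∀ {H K} n → (∀ i j → i ℕ.+ j ≡ n → H i j ≡ K i j) → diagℤ H n ≡ diagℤ K n
diagℤ-cong-at zero    e = e 0 0 ≡.refl
diagℤ-cong-at (suc n) e =
  ≡.cong₂ _+ℤ_ (e 0 (suc n) ≡.refl) (diagℤ-cong-at n (λ i j i+j≡n → e (suc i) j (≡.cong suc i+j≡n)))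

diagℤ-zero : ∀ {H} n → (∀ i j → i ℕ.+ j ≡ n → H i j ≡ 0ℤ) → diagℤ H n ≡ 0ℤ
diagℤ-zero zero    e = e 0 0 ≡.refl
diagℤ-zero (suc n) e =
  ≡.cong₂ _+ℤ_ (e 0 (suc n) ≡.refl) (diagℤ-zero n (λ i j i+j≡n → e (suc i) j (≡.cong suc i+j≡n)))

Σ<-antidiagonal : ∀ H n → Σ< (suc n) (λ k → H k (n ∸ k)) ≡ diagℤ H n
Σ<-antidiagonal H zero    = ℤₚ.+-identityˡ _
Σ<-antidiagonal H (suc n) = ≡.trans (Σ<-head (suc n) (λ k → H k (suc n ∸ k)))
  (≡.cong (H 0 (suc n) +ℤ_) (Σ<-antidiagonal (H ∘ suc) n))

-- The ring of integer power series in q.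

⊛-diag : ∀ a b n → (a ⊛ b) n ≡ diagℤ (λ i j → a i *ℤ b j) n
⊛-diag a b = Σ<-antidiagonal (λ i j → a i *ℤ b j)

⊛-cong-at : ∀ {a a′ b b′} n → (∀ k → k ℕ.≤ n → a k ≡ a′ k) → (∀ k → k ℕ.≤ n → b k ≡ b′ k) →
            (a ⊛ b) n ≡ (a′ ⊛ b′) n
⊛-cong-at {a} {a′} {b} {b′} n ea eb = ≡.trans (⊛-diag a b n) (≡.trans
  (diagℤ-cong-at n (λ i j i+j≡n → ≡.cong₂ _*ℤ_
    (ea i (≡.subst (i ℕ.≤_) i+j≡n (ℕₚ.m≤m+n i j)))
    (eb j (≡.subst (j ℕ.≤_) i+j≡n (ℕₚ.m≤n+m j i)))))
  (≡.sym (⊛-diag a′ b′ n)))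

one≗δ : ∀ n → one n ≡ ℤSeries.δ n
one≗δ zero    = ≡.refl
one≗δ (suc n) = ≡.refl

powerSeriesRawRing : RawRing _ _
powerSeriesRawRing = record
  { Carrier = FPS
  ; _≈_ = λ a b → ∀ n → a n ≡ b n
  ; _+_ = _⊕_
  ; _*_ = _⊛_
  ; -_ = λ a n → ℤ.- a n
  ; 0# = λ _ → 0ℤ
  ; 1# = one
  }

-- Transports the ring laws from `seriesRing`: the carriers agree, and only the formulas for product
-- and unit differ.
id-isRingMonomorphism :
  IsRingMonomorphism powerSeriesRawRing (CommutativeRing.rawRing ℤSeries.seriesRing) id
id-isRingMonomorphism = record
  { isRingHomomorphism = record
    { isSemiringHomomorphism = record
      { isNearSemiringHomomorphism = record
        { +-isMonoidHomomorphism = record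
          { isMagmaHomomorphism = record
            { isRelHomomorphism = record { cong = id }
            ; homo = λ _ _ _ → ≡.refl
            }
          ; ε-homo = λ _ → ≡.refl
          }
        ; *-homo = ⊛-diag
        }
      ; 1#-homo = one≗δ
      }
    ; -‿homo = λ _ _ → ≡.refl
    }
  ; injective = id
  }

powerSeriesRing : CommutativeRing _ _
powerSeriesRing = record
  { isCommutativeRing = RingMonomorphism.isCommutativeRing id-isRingMonomorphism
      (CommutativeRing.isCommutativeRing ℤSeries.seriesRing)
  }

-- Monomials, shifts and geometric series in q.

shift-suc : ∀ e a n → shift (suc e) a (suc n) ≡ shift e a n
shift-suc e a n with e ≤? n | suc e ≤? suc n
... | yes _   | yes _   = ≡.refl
... | no _    | no _    = ≡.refl
... | yes e≤n | no e≰n  = contradiction (ℕ.s≤s e≤n) e≰n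
... | no e≰n  | yes e≤n = contradiction (ℕ.s≤s⁻¹ e≤n) e≰n

shift-small : ∀ {e n} a → n ℕ.< e → shift e a n ≡ 0ℤ
shift-small {e} {n} a n<e with e ≤? n
... | yes e≤n = contradiction e≤n (ℕₚ.<⇒≱ n<e)
... | no _    = ≡.refl

mon-suc : ∀ e n → mon (suc e) (suc n) ≡ mon e n
mon-suc e n with n ≟ e | suc n ≟ suc e
... | yes _   | yes _   = ≡.refl
... | no _    | no _    = ≡.refl
... | yes n≡e | no n≢e  = contradiction (≡.cong suc n≡e) n≢e
... | no n≢e  | yes n≡e = contradiction (ℕₚ.suc-injective n≡e) n≢e

mon-⊛ : ∀ e a n → (mon e ⊛ a) n ≡ shift e a n
mon-⊛ e a n = ≡.trans (⊛-diag (mon e) a n) (go e n)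
  where
  go : ∀ e n → diagℤ (λ i j → mon e i *ℤ a j) n ≡ shift e a n
  go zero    zero    = ℤₚ.*-identityˡ (a 0)
  go zero    (suc n) = ≡.trans (≡.cong₂ _+ℤ_ (ℤₚ.*-identityˡ (a (suc n)))
    (diagℤ-zero n (λ _ j _ → ℤₚ.*-zeroˡ (a j)))) (ℤₚ.+-identityʳ _)
  go (suc e) zero    = ℤₚ.*-zeroˡ (a 0)
  go (suc e) (suc n) = ≡.trans (≡.cong₂ _+ℤ_ (ℤₚ.*-zeroˡ (a (suc n)))
    (≡.trans (diagℤ-cong-at n (λ i j _ → ≡.cong (_*ℤ a j) (mon-suc e i))) (go e n)))
    (≡.trans (ℤₚ.+-identityˡ _) (≡.sym (shift-suc e a n)))

mon-+ : ∀ d e n → mon (d ℕ.+ e) n ≡ (mon d ⊛ mon e) n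
mon-+ d e n = ≡.trans (go d n) (≡.sym (mon-⊛ d (mon e) n))
  where
  go : ∀ d n → mon (d ℕ.+ e) n ≡ shift d (mon e) n
  go zero    n       = ≡.refl
  go (suc d) zero    = ≡.refl
  go (suc d) (suc n) = ≡.trans (mon-suc (d ℕ.+ e) n) (≡.trans (go d n) (≡.sym (shift-suc d (mon e) n)))

mon-small : ∀ {e n} → n ℕ.< e → mon e n ≡ 0ℤ
mon-small {e} {n} n<e with n ≟ e
... | yes n≡e = contradiction n≡e (ℕₚ.<⇒≢ n<e)
... | no _    = ≡.refl

geom-yes : ∀ {k n} → k ∣ n → geom k n ≡ 1ℤ
geom-yes {k} {n} k∣n with k ∣? n
... | yes _  = ≡.refl
... | no k∤n = contradiction k∣n k∤n

geom-no : ∀ {k n} → ¬ k ∣ n → geom k n ≡ 0ℤ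
geom-no {k} {n} k∤n with k ∣? n
... | yes k∣n = contradiction k∣n k∤n
... | no _    = ≡.refl

geom-shift : ∀ k n → geom (suc k) n ≡ one n +ℤ shift (suc k) (geom (suc k)) n
geom-shift k n with suc k ≤? n
geom-shift k zero    | no _    = geom-yes (suc k ∣0)
geom-shift k (suc n) | no k≰n  = geom-no (>⇒∤ (ℕₚ.≰⇒> k≰n))
-- From here on the unit contributes 0, and subtracting the modulus preserves divisibility in both
-- directions.
geom-shift k (suc n) | yes k≤n with suc k ∣? suc n
... | yes k∣n = ≡.sym (≡.cong (0ℤ +ℤ_) (geom-yes (∣m+n∣m⇒∣n (≡.subst (suc k ∣_) (≡.sym (ℕₚ.m+[n∸m]≡n k≤n)) k∣n) ∣-refl)))
... | no k∤n  = ≡.sym (≡.cong (0ℤ +ℤ_) (geom-no (λ k∣n∸k → k∤n (∣m∸n∣n⇒∣m (suc k) k≤n k∣n∸k ∣-refl))))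

open CommutativeRing powerSeriesRing
open Exp commutativeSemiring

mon1-^ : ∀ n → mon 1 ^ n ≈ mon n
mon1-^ zero    zero    = ≡.refl
mon1-^ zero    (suc n) = ≡.refl
mon1-^ (suc n) = trans (*-congˡ {mon 1} (mon1-^ n)) (sym (mon-+ 1 n))

geom-geometric : Geometric powerSeriesRing (mon 1) geom
geom-geometric k = trans (λ n → ≡.trans (geom-shift k n) (≡.cong (one n +ℤ_) (≡.sym (mon-⊛ (suc k) (geom (suc k)) n))))
  (+-congˡ {one} (*-congʳ {geom (suc k)} (sym (mon1-^ (suc k)))))

open Coefficients powerSeriesRing (mon 1) geom geom-geometric

p^-mon : ∀ n → p ^ n ≈ mon (3 ℕ.* n)
p^-mon n = trans (^-assocʳ (mon 1) 3 n) (mon1-^ (3 ℕ.* n))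

-- Order in q and convergent sums.

Order : ℕ → FPS → Set
Order k f = ∀ n → n ℕ.< k → f n ≡ 0ℤ

Order-+ : ∀ {k f g} → Order k f → Order k g → Order k (f + g)
Order-+ of og n n<k = ≡.cong₂ _+ℤ_ (of n n<k) (og n n<k)

Order-* : ∀ {i j f g} → Order i f → Order j g → Order (i ℕ.+ j) (f * g)
Order-* {i} {j} {f} {g} of og n n<i+j = ≡.trans (⊛-diag f g n) (diagℤ-zero n vanish)
  where
  vanish : ∀ k l → k ℕ.+ l ≡ n → f k *ℤ g l ≡ 0ℤ
  vanish k l k+l≡n with ℕₚ.<-≤-connex k i | ℕₚ.<-≤-connex l j
  ... | inj₁ k<i | _        = ≡.trans (≡.cong (_*ℤ g l) (of k k<i)) (ℤₚ.*-zeroˡ (g l))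
  ... | inj₂ _   | inj₁ l<j = ≡.trans (≡.cong (f k *ℤ_) (og l l<j)) (ℤₚ.*-zeroʳ (f k))
  ... | inj₂ i≤k | inj₂ j≤l = contradiction (ℕₚ.+-mono-≤ i≤k j≤l)
        (ℕₚ.<⇒≱ (≡.subst (ℕ._< i ℕ.+ j) (≡.sym k+l≡n) n<i+j))

Order-≈ : ∀ {k f g} → f ≈ g → Order k g → Order k f
Order-≈ e og n n<k = ≡.trans (e n) (og n n<k)

Order-*ˡ : ∀ {k} c {f} → Order k f → Order k (c * f)
Order-*ˡ c of = Order-* {0} {f = c} (λ _ ()) of

Order-mon : ∀ e → Order e (mon e)
Order-mon e n n<e = mon-small n<e

Order-p^ : ∀ m c → Order m (p ^ m * c)
Order-p^ m c n n<m = ≡.trans (*-congʳ {c} (p^-mon m) n)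
  (≡.trans (mon-⊛ (3 ℕ.* m) c n) (shift-small c (ℕₚ.<-≤-trans n<m (ℕₚ.m≤n*m m 3))))

Order-q* : ∀ j {k f} → Order k f → Order (suc k) (mon 1 ^ suc j * f)
Order-q* j {k} {f} of = Order-≈ (*-assoc (mon 1) (mon 1 ^ j) f)
  (Order-* (Order-mon 1) (Order-*ˡ (mon 1 ^ j) of))

-- With this rate of convergence the coefficient of q^n in Σ_k F k only involves k < n + 2.
Summable : (ℕ → FPS) → Set
Summable F = ∀ k n → 2 ℕ.+ n ℕ.≤ k → F k n ≡ 0ℤ

S : (ℕ → FPS) → FPS
S F n = Σ< (2 ℕ.+ n) (λ k → F k n)

S-cong : ∀ {F H} → (∀ k → F k ≈ H k) → S F ≈ S H
S-cong e n = Σ<-cong (2 ℕ.+ n) (λ k → e k n)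

S-+ : ∀ F H → S (λ k → F k + H k) ≈ S F + S H
S-+ F H n = Σ<-+ (2 ℕ.+ n) (λ k → F k n) (λ k → H k n)

S-bound : ∀ {F B} n → Summable F → 2 ℕ.+ n ℕ.≤ B → S F n ≡ Σ< B (λ k → F k n)
S-bound n sF n+2≤B = Σ<-extend n+2≤B (λ k → sF k n)

S-head : ∀ {F} → Summable F → S F ≈ F 0 + S (F ∘ suc)
S-head {F} sF n = ≡.trans (S-bound n sF (ℕₚ.n≤1+n _)) (Σ<-head (2 ℕ.+ n) (λ k → F k n))

S-* : ∀ c {F} → Summable F → S (λ k → c * F k) ≈ c * S F
S-* c {F} sF n = ≡.trans (Σ<-swap (2 ℕ.+ n) (suc n) (λ k i → c i *ℤ F k (n ∸ i)))
  (Σ<-cong (suc n) (λ i → ≡.trans (Σ<-*ˡ (2 ℕ.+ n) (c i) (λ k → F k (n ∸ i)))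
    -- On the right the sum for coefficient n - i stops at its own cutoff 2 + (n - i); summability
    -- extends it by zeros to 2 + n.
    (≡.cong (c i *ℤ_) (≡.sym (S-bound (n ∸ i) sF (ℕ.s≤s (ℕ.s≤s (ℕₚ.m∸n≤m n i))))))))

Summable-* : ∀ (c : ℕ → FPS) {F} → Summable F → Summable (λ k → c k * F k)
Summable-* c {F} sF k n n+2≤k = Order-*ˡ {suc n} (c k)
  (λ m m≤n → sF k m (ℕₚ.≤-trans (ℕ.s≤s m≤n) n+2≤k)) n ℕₚ.≤-refl

diag-coefficient : ∀ H n N → diag H n N ≡ diagℤ (λ i j → H i j N) n
diag-coefficient H zero    N = ≡.refl
diag-coefficient H (suc n) N = ≡.cong (H 0 (suc n) N +ℤ_) (diag-coefficient (H ∘ suc) n N)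

-- The inner bound is left free: the double sum over m and n needs twice the outer bound, the
-- regrouping by s needs an equal one.
S-diag : ∀ {H} N {B} → 2 ℕ.+ N ℕ.≤ B → (∀ i j → 2 ℕ.+ N ℕ.≤ i ℕ.+ j → H i j N ≡ 0ℤ) →
  S (diag H) N ≡ Σ< (2 ℕ.+ N) (λ i → Σ< B (λ j → H i j N))
S-diag {H} N N+2≤B e = ≡.trans (Σ<-cong (2 ℕ.+ N) (λ k → diag-coefficient H k N))
  (Σ<-diag (2 ℕ.+ N) (λ i j → H i j N) N+2≤B e)

-- Evaluation at powers of p and infinite products.

-- f(p^s), for f a power series in z.
ev : ℕ → Seq → FPS
ev s f = S (λ n → (p ^ s) ^ n * f n)

-- The hypotheses say f(z) = (1 + cz)h(pz); this is that identity at z = p^s, obtained by splitting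
-- off the constant term and dilating the rest by p^s.
ev-step : ∀ s c f h → Summable f → Summable h → f 0 ≈ h 0 →
  (∀ n → f (suc n) ≈ p ^ suc n * h (suc n) + c * (p ^ n * h n)) →
  ev s f ≈ (1# + c * p ^ s) * ev (suc s) h
ev-step s c f h sf sh e₀ e = begin
  ev s f
    ≈⟨ S-head (Summable-* (r ^_) {f} sf) ⟩
  1# * f 0 + S (λ n → r ^ suc n * f (suc n))
    ≈⟨ +-cong (*-congˡ {1#} e₀) (S-cong (λ n → dilate p r c f h n (e n))) ⟩
  1# * h 0 + S (λ n → (p * r) ^ suc n * h (suc n) + (c * r) * ((p * r) ^ n * h n))
    ≈⟨ +-congˡ {1# * h 0} (S-+ (λ n → (p * r) ^ suc n * h (suc n)) (λ n → (c * r) * ((p * r) ^ n * h n))) ⟩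
  1# * h 0 + (S (λ n → (p * r) ^ suc n * h (suc n)) + S (λ n → (c * r) * ((p * r) ^ n * h n)))
    ≈⟨ +-assoc (1# * h 0) (S (λ n → (p * r) ^ suc n * h (suc n))) (S (λ n → (c * r) * ((p * r) ^ n * h n))) ⟨
  1# * h 0 + S (λ n → (p * r) ^ suc n * h (suc n)) + S (λ n → (c * r) * ((p * r) ^ n * h n))
    ≈⟨ +-cong (sym (S-head sh′)) (S-* (c * r) sh′) ⟩
  ev (suc s) h + (c * r) * ev (suc s) h
    ≈⟨ +-congʳ {(c * r) * ev (suc s) h} (*-identityˡ (ev (suc s) h)) ⟨
  1# * ev (suc s) h + (c * r) * ev (suc s) h
    ≈⟨ distribʳ (ev (suc s) h) 1# (c * r) ⟨
  (1# + c * r) * ev (suc s) h ∎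
  where
  open SetoidReasoning setoid
  r : FPS
  r = p ^ s
  sh′ : Summable (λ n → (p * r) ^ n * h n)
  sh′ = Summable-* ((p * r) ^_) {h} sh

-- All terms after the constant one are divisible by p^s. This makes the remainder of a telescoping
-- product invisible in low coefficients.
ev-one : ∀ {s n f} → f 0 ≈ 1# → n ℕ.< s → ev s f n ≡ one n
ev-one {s} {n} {f} f₀ n<s = ≡.trans (Σ<-head (suc n) (λ k → ((p ^ s) ^ k * f k) n))
  (≡.trans (≡.cong₂ _+ℤ_ (trans (*-identityˡ (f 0)) f₀ n)
    (Σ<-zero (suc n) (λ k → ≡.trans (*-assoc (p ^ s) ((p ^ s) ^ k) (f (suc k)) n)
      (Order-p^ s ((p ^ s) ^ k * f (suc k)) n n<s))))
  (ℤₚ.+-identityʳ _))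

*-one-at : ∀ f {h} n → (∀ k → k ℕ.≤ n → h k ≡ one k) → (f * h) n ≡ f n
*-one-at f {h} n e = ≡.trans (⊛-cong-at {f} {f} {h} {one} n (λ _ _ → ≡.refl) e) (*-identityʳ f n)

ev-zero : ∀ f → ev 0 f ≈ S f
ev-zero f = S-cong (λ n → trans (*-congʳ {f n} (1^n≈1 n)) (*-identityˡ (f n)))

factor : ℕ → ℕ → ℕ → FPS
factor c d i = one ⊕ mon (c ℕ.+ d ℕ.* i)

-- The factor of index M > n is 1 plus a power of q whose exponent exceeds M, so it cannot change
-- the coefficient of q^n.
negPoch∞-stable : ∀ c d {n M} → n ℕ.< M →
  ∏< M (factor (suc c) (suc d)) n ≡ negPoch∞ (suc c) (suc d) n
negPoch∞-stable c d {n} {M} n<M = go (ℕₚ.≤⇒≤′ n<M)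
  where
  go : ∀ {M} → suc n ℕ.≤′ M → ∏< M (factor (suc c) (suc d)) n ≡ negPoch∞ (suc c) (suc d) n
  go ℕ.≤′-refl = ≡.refl
  go {suc M} (ℕ.≤′-step n<M) = ≡.trans (*-one-at (∏< M (factor (suc c) (suc d))) n (λ k k≤n →
    ≡.trans (≡.cong (one k +ℤ_) (mon-small {suc c ℕ.+ suc d ℕ.* M}
      (ℕₚ.<-≤-trans (ℕₚ.<-≤-trans (ℕ.s≤s k≤n) (ℕₚ.≤′⇒≤ n<M))
        (ℕₚ.≤-trans (ℕₚ.m≤n*m M (suc d)) (ℕₚ.m≤n+m (suc d ℕ.* M) (suc c))))))
      (ℤₚ.+-identityʳ _))) (go n<M)

q^-mon : ∀ c s → mon 1 ^ c * p ^ s ≈ mon (c ℕ.+ 3 ℕ.* s)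
q^-mon c s = trans (*-cong (mon1-^ c) (p^-mon s)) (sym (mon-+ c (3 ℕ.* s)))

y-Summable : Summable y
y-Summable k n n+2≤k = Order-p^ (tri k) (w k) n (tri-lower k n+2≤k)

G-∏ : ∀ s → G s ≈ ∏< s (factor 3 3)
G-∏ zero    = refl
G-∏ (suc s) = *-cong (G-∏ s) (+-congˡ {one} (trans (p^-mon (suc s))
  (reflexive (≡.cong mon (ℕₚ.*-suc 3 s)))))

y-step : ∀ s → ev s y ≈ (1# + p ^ s) * ev (suc s) y
y-step s = trans (ev-step s 1# y y y-Summable y-Summable refl y-suc)
  (*-congʳ {ev (suc s) y} (+-congˡ {1#} (*-identityˡ (p ^ s))))

-- Telescoping of (-p;p)_s (-p^{s+1};p)_∞ = (-p;p)_∞, so that every summand in s shares one product.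
G-ev : ∀ s → G s * ev (suc s) y ≈ ev 1 y
G-ev zero    = *-identityˡ (ev 1 y)
G-ev (suc s) = trans (*-assoc (G s) (1# + p ^ suc s) (ev (2 ℕ.+ s) y))
  (trans (*-congˡ {G s} (sym (y-step (suc s)))) (G-ev s))

ev-y : ev 1 y ≈ negPoch∞ 3 3
-- Taking s = n + 1 leaves a tail that agrees with 1 through the coefficient of q^n.
ev-y n = ≡.trans (≡.sym (G-ev (suc n) n))
  (≡.trans (*-one-at (G (suc n)) n (λ k k≤n → ev-one {f = y} (*-identityˡ 1#) (ℕ.s≤s (ℕₚ.m≤n⇒m≤1+n k≤n))))
  (G-∏ (suc n) n))

-- Composing the two equations gives f(z) = (1 + q^{c+1}z)(1 + q^{d+3}z)f(p²z). Iterating from z = 1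
-- yields two products with step p² = q⁶, and the tail f(p^{2M}) tends to 1.
ev-product : ∀ c d f h → Summable f → Summable h → f 0 ≈ 1# → h 0 ≈ 1# →
  (∀ n → f (suc n) ≈ p ^ suc n * h (suc n) + mon 1 ^ suc c * (p ^ n * h n)) →
  (∀ n → h (suc n) ≈ p ^ suc n * f (suc n) + mon 1 ^ d * (p ^ n * f n)) →
  S f ≈ negPoch∞ (suc c) 6 * negPoch∞ (3 ℕ.+ d) 6
ev-product c d f h sf sh f₀ h₀ ef eh n = ≡.trans (≡.sym (trans (ev-partial (suc n)) (ev-zero f) n))
  (≡.trans (*-one-at (A (suc n) * B (suc n)) n (λ k k≤n →
      ev-one {f = f} f₀ (ℕₚ.≤-trans (ℕ.s≤s k≤n) (ℕₚ.m≤m+n (suc n) (1 ℕ.* suc n)))))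
  (⊛-cong-at n (λ k k≤n → negPoch∞-stable c 5 (ℕ.s≤s k≤n)) (λ k k≤n → negPoch∞-stable (2 ℕ.+ d) 5 (ℕ.s≤s k≤n))))
  where
  open SetoidReasoning setoid
  A B : ℕ → FPS
  A M = ∏< M (factor (suc c) 6)
  B M = ∏< M (factor (3 ℕ.+ d) 6)
  double-step : ∀ M → ev (2 ℕ.* M) f ≈ factor (suc c) 6 M * (factor (3 ℕ.+ d) 6 M * ev (2 ℕ.* suc M) f)
  double-step M = trans (ev-step (2 ℕ.* M) (mon 1 ^ suc c) f h sf sh (trans f₀ (sym h₀)) ef)
    (*-cong (+-congˡ {one} (trans (q^-mon (suc c) (2 ℕ.* M)) (reflexive (≡.cong mon
      (≡.cong (suc c ℕ.+_) (≡.sym (ℕₚ.*-assoc 3 2 M)))))))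
    (trans (ev-step (suc (2 ℕ.* M)) (mon 1 ^ d) h f sh sf (trans h₀ (sym f₀)) eh)
    (*-cong (+-congˡ {one} (trans (q^-mon d (suc (2 ℕ.* M))) (reflexive (≡.cong mon
      (solve 2 (λ d M → d :+ con 3 :* (con 1 :+ con 2 :* M) := con 3 :+ d :+ con 6 :* M) ≡.refl d M)))))
      (reflexive (≡.cong (λ s → ev s f) (≡.sym (ℕₚ.*-suc 2 M)))))))
    where open ℕSolver
  ev-partial : ∀ M → (A M * B M) * ev (2 ℕ.* M) f ≈ ev 0 f
  ev-partial zero    = trans (*-congʳ {ev 0 f} (*-identityˡ 1#)) (*-identityˡ (ev 0 f))
  ev-partial (suc M) = begin
    (A M * x * (B M * z)) * t  ≈⟨ RingLemmas.*-interchange₅ powerSeriesRing (A M) x (B M) z t ⟩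
    (A M * B M) * (x * (z * t))  ≈⟨ *-congˡ {A M * B M} (double-step M) ⟨
    (A M * B M) * ev (2 ℕ.* M) f  ≈⟨ ev-partial M ⟩
    ev 0 f ∎
    where
    x z t : FPS
    x = factor (suc c) 6 M
    z = factor (3 ℕ.+ d) 6 M
    t = ev (2 ℕ.* suc M) f

-- The sums X(1) and Y(1).

X-Order : ∀ s → Order s (X s)
Y-Order : ∀ s → Order s (Y s)
X-Order zero    _ ()
-- Every term of the recurrence carries a = q or b = q², so the order grows by at least one per
-- step.
X-Order (suc s) = Order-*ˡ (geom (6 ℕ.* suc s)) (Order-+
  (Order-*ˡ (p ^ suc s) (Order-q* 0 (Order-*ˡ (p ^ s) (X-Order s))))
  (Order-q* 1 (Order-*ˡ (p ^ s) (Y-Order s))))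
Y-Order zero    _ ()
Y-Order (suc s) = Order-+ (Order-*ˡ (p ^ suc s) (X-Order (suc s)))
  (Order-q* 0 (Order-*ˡ (p ^ s) (X-Order s)))

X-Summable : Summable X
X-Summable k n n+2≤k = X-Order k n (ℕₚ.<⇒≤ n+2≤k)

Y-Summable : Summable Y
Y-Summable k n n+2≤k = Y-Order k n (ℕₚ.<⇒≤ n+2≤k)

-- The exponents of b = q² and a = q enter as c + 1 = 2 and d = 1; for `S-Y` the two exchange roles.
S-X : S X ≈ negPoch∞ 2 6 * negPoch∞ 4 6
S-X = ev-product 1 1 X Y X-Summable Y-Summable refl refl X-suc (λ _ → refl)

S-Y : S Y ≈ negPoch∞ 1 6 * negPoch∞ 5 6
S-Y = ev-product 0 2 Y X Y-Summable X-Summable refl refl (λ _ → refl) X-suc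

-- The double sum and its evaluation.

expo-tri : ∀ m n → expo m n ≡ 3 ℕ.* tri (m ℕ.+ (n ℕ.+ n)) ℕ.+ tri m
expo-tri m n = ≡.trans (≡.cong (_∸ (2 ℕ.* m ℕ.+ 3 ℕ.* n)) (≡.sym total))
  (ℕₚ.m+n∸n≡m (3 ℕ.* tri k ℕ.+ tri m) (2 ℕ.* m ℕ.+ 3 ℕ.* n))
  where
  open ℕSolver
  k : ℕ
  k = m ℕ.+ (n ℕ.+ n)
  total : 3 ℕ.* tri k ℕ.+ tri m ℕ.+ (2 ℕ.* m ℕ.+ 3 ℕ.* n)
    ≡ 2 ℕ.* m ℕ.* m ℕ.+ 6 ℕ.* m ℕ.* n ℕ.+ 6 ℕ.* n ℕ.* n
  -- Doubling clears the halves in the triangular numbers, so 2 tri k + k = k² applies to both.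
  total = ℕₚ.*-cancelˡ-≡ _ _ 2 (≡.trans
    (solve 4 (λ T U m n → con 2 :* (con 3 :* T :+ U :+ (con 2 :* m :+ con 3 :* n))
       := con 3 :* (con 2 :* T :+ (m :+ (n :+ n))) :+ (con 2 :* U :+ m)) ≡.refl (tri k) (tri m) m n)
    (≡.trans (≡.cong₂ (λ x y → 3 ℕ.* x ℕ.+ y) (2*tri+n≡n² k) (2*tri+n≡n² m))
    (solve 2 (λ m n → con 3 :* ((m :+ (n :+ n)) :* (m :+ (n :+ n))) :+ m :* m
       := con 2 :* (con 2 :* m :* m :+ con 6 :* m :* n :+ con 6 :* n :* n)) ≡.refl m n)))

invPoch-invPochhammer : ∀ d n → invPoch d n ≈ invPochhammer d n
invPoch-invPochhammer d zero    = refl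
invPoch-invPochhammer d (suc n) = *-congʳ {geom (d ℕ.* suc n)} (invPoch-invPochhammer d n)

term-weighted : ∀ m n → term m n ≈ p ^ tri (m ℕ.+ (n ℕ.+ n)) * (u m * w n)
term-weighted m n = begin
  shift (expo m n) (invPoch 1 m * invPoch 3 n)
    ≈⟨ (λ N → ≡.sym (mon-⊛ (expo m n) (invPoch 1 m * invPoch 3 n) N)) ⟩
  mon (expo m n) * (invPoch 1 m * invPoch 3 n)
    ≈⟨ *-cong (trans (reflexive (≡.cong mon (expo-tri m n)))
         (trans (mon-+ (3 ℕ.* T) (tri m)) (*-cong (sym (p^-mon T)) (sym (mon1-^ (tri m))))))
       (*-cong (invPoch-invPochhammer 1 m) (invPoch-invPochhammer 3 n)) ⟩
  p ^ T * mon 1 ^ tri m * (invPochhammer 1 m * w n)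
    ≈⟨ *-assoc (p ^ T) (mon 1 ^ tri m) (invPochhammer 1 m * w n) ⟩
  p ^ T * (mon 1 ^ tri m * (invPochhammer 1 m * w n))
    ≈⟨ *-congˡ {p ^ T} (*-assoc (mon 1 ^ tri m) (invPochhammer 1 m) (w n)) ⟨
  p ^ T * (u m * w n) ∎
  where
  open SetoidReasoning setoid
  T : ℕ
  T = tri (m ℕ.+ (n ℕ.+ n))

-- Writes k = m + j. Odd j vanish because v(z) is a series in z²; j runs below 2(N + 2), so that n
-- with j = 2n runs below N + 2, exactly as in `lhs`.
lhs-weighted : lhs ≈ S (λ k → p ^ tri k * (u ⋆ v) k)
lhs-weighted N = ≡.sym (≡.trans (S-cong (diag-weight (λ k → p ^ tri k) (λ i j → u i * v j)) N)
  (≡.trans (S-diag {H} N (ℕₚ.m≤m+n (2 ℕ.+ N) (2 ℕ.+ N))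
    (λ i j N+2≤ → Order-p^ (tri (i ℕ.+ j)) (u i * v j) N (tri-lower (i ℕ.+ j) N+2≤)))
  (Σ<-cong (2 ℕ.+ N) (λ m → ≡.trans (Σ<-even (2 ℕ.+ N) (λ j → H m j N) (odd m))
    (Σ<-cong (2 ℕ.+ N) (λ n → even m n N))))))
  where
  H : ℕ → ℕ → FPS
  H i j = p ^ tri (i ℕ.+ j) * (u i * v j)
  odd : ∀ m n → H m (suc (n ℕ.+ n)) N ≡ 0ℤ
  odd m n = trans (*-congˡ {p ^ tri (m ℕ.+ suc (n ℕ.+ n))}
    (trans (*-congˡ {u m} (spread-odd w n)) (zeroʳ (u m)))) (zeroʳ (p ^ tri (m ℕ.+ suc (n ℕ.+ n)))) N
  even : ∀ m n → H m (n ℕ.+ n) ≈ term m n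
  even m n = sym (trans (term-weighted m n)
    (*-congˡ {p ^ tri (m ℕ.+ (n ℕ.+ n))} (*-congˡ {u m} (sym (spread-even w n)))))

S-e⋆w : S (λ k → p ^ tri k * (e ⋆ w) k) ≈ S (λ s → ev 1 y * (X s + Y s))
S-e⋆w = trans (S-cong (diag-weight (λ k → p ^ tri k) (λ s n → e s * w n)))
  (trans (λ N → S-diag {H} N ℕₚ.≤-refl
    (λ s n N+2≤ → Order-p^ (tri (s ℕ.+ n)) (e s * w n) N (tri-lower (s ℕ.+ n) N+2≤)))
  (S-cong row))
  where
  open SetoidReasoning setoid
  H : ℕ → ℕ → FPS
  H s n = p ^ tri (s ℕ.+ n) * (e s * w n)
  row : ∀ s → S (H s) ≈ ev 1 y * (X s + Y s)
  row s = begin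
    S (H s)                          ≈⟨ S-cong (E-y-term s) ⟩
    S (λ n → E s * ((p ^ s) ^ n * y n))  ≈⟨ S-* (E s) (Summable-* ((p ^ s) ^_) {y} y-Summable) ⟩
    -- Splitting 1 + p^s off (-p^s;p)_∞ provides the factor with which `E-closed` applies, so
    -- nothing is divided by 1 + p^s.
    E s * ev s y                     ≈⟨ *-congˡ {E s} (y-step s) ⟩
    E s * ((1# + p ^ s) * ev (suc s) y) ≈⟨ *-assoc (E s) (1# + p ^ s) (ev (suc s) y) ⟨
    E s * (1# + p ^ s) * ev (suc s) y
      ≈⟨ *-congʳ {ev (suc s) y} (trans (*-comm (E s) (1# + p ^ s)) (E-closed s)) ⟩
    (X s + Y s) * G s * ev (suc s) y ≈⟨ *-assoc (X s + Y s) (G s) (ev (suc s) y) ⟩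
    (X s + Y s) * (G s * ev (suc s) y) ≈⟨ *-congˡ {X s + Y s} (G-ev s) ⟩
    (X s + Y s) * ev 1 y             ≈⟨ *-comm (X s + Y s) (ev 1 y) ⟩
    ev 1 y * (X s + Y s)             ∎

lhs≈rhs : lhs ≈ rhs
lhs≈rhs = begin
  lhs                                     ≈⟨ lhs-weighted ⟩
  S (λ k → p ^ tri k * (u ⋆ v) k)         ≈⟨ S-cong (λ k → *-congˡ {p ^ tri k} (u⋆v≋e⋆w k)) ⟩
  S (λ k → p ^ tri k * (e ⋆ w) k)         ≈⟨ S-e⋆w ⟩
  S (λ s → ev 1 y * (X s + Y s))
    ≈⟨ S-* (ev 1 y) {λ s → X s + Y s} (λ k n n+2≤k → ≡.cong₂ _+ℤ_ (X-Summable k n n+2≤k) (Y-Summable k n n+2≤k)) ⟩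
  ev 1 y * S (λ s → X s + Y s)            ≈⟨ *-cong ev-y (trans (S-+ X Y) (+-cong S-X S-Y)) ⟩
  negPoch∞ 3 3 * (P + P′)                 ≈⟨ *-comm (negPoch∞ 3 3) (P + P′) ⟩
  (P + P′) * negPoch∞ 3 3                 ≈⟨ distribʳ (negPoch∞ 3 3) P P′ ⟩
  rhs                                     ∎
  where
  open SetoidReasoning setoid
  P P′ : FPS
  P  = negPoch∞ 2 6 * negPoch∞ 4 6
  P′ = negPoch∞ 1 6 * negPoch∞ 5 6

theorem1p2 : (N : ℕ) → lhs N ≡ rhs N
theorem1p2 = lhs≈rhs
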